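{- Let $n\ge 1$, $\mathbf{x}=(x_1,\ldots,x_n)$, $\overline{\mathbf{x}}=(\overline{x}_1,\ldots,\overline{x}_n)$ with $\overline{x}_i=x_i^{ -1}$, and for $i=1,\ldots,n$ put $\mathbf{x}^{(i)}=(x_i,x_{i+1},\ldots,x_n)$ and $\overline{\mathbf{x}}^{(i)}=(\overline{x}_i,\overline{x}_{i+1},\ldots,\overline{x}_n)$. Then for any partition $\lambda=(\lambda_1,\ldots,\lambda_n)$ of length $\ell(\lambda)\le n$ and any sequence $\mathbf{a}=(a_1,a_2,\ldots)$, $$s_\lambda(\mathbf{x}\,|\,\mathbf{a})=\det\big(h_{\lambda_j-j+i}(\mathbf{x}^{(i)}\,|\,\mathbf{a})\big)_{1\le i,j\le n},$$ $$sp_\lambda(\mathbf{x},\overline{\mathbf{x}}\,|\,\mathbf{a})=\det\big(h^{sp}_{\lambda_j-j+i}(\mathbf{x}^{(i)},\overline{\mathbf{x}}^{(i)}\,|\,\mathbf{a})\big)_{1\le i,j\le n},$$ $$so_\lambda(\mathbf{x},\overline{\mathbf{x}},1\,|\,\mathbf{a})=\det\big(h^{so}_{\lambda_j-j+i}(\mathbf{x}^{(i)},\overline{\mathbf{x}}^{(i)},1\,|\,\mathbf{a})\big)_{1\le i,j\le n}.$$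
   Context: The $x_i$ are indeterminates (with formal square roots $x_i^{1/2}$, and $\overline{x}_i^{1/2}=(x_i^{1/2})^{ -1}$), and $\mathbf{a}=(a_1,a_2,\ldots)$ is an infinite sequence of parameters. A partition $\lambda=(\lambda_1\ge\cdots\ge\lambda_n\ge0)$ is padded with zeros to $n$ parts. All determinants are $n\times n$ with row index $i$ and column index $j$. Factorial powers: for $z=x_i$ or $z=\overline{x}_i$, $(z\,|\,\mathbf{a})^m=(z+a_1)(z+a_2)\cdots(z+a_m)$ for $m>0$ and $(z\,|\,\mathbf{a})^0=1$. Factorial characters (general linear, symplectic, odd orthogonal): $$s_\lambda(\mathbf{x}|\mathbf{a})=\frac{\det\big((x_i|\mathbf{a})^{\lambda_j+n-j}\big)}{\det\big((x_i|\mathbf{a})^{n-j}\big)},$$ $$sp_\lambda(\mathbf{x},\overline{\mathbf{x}}|\mathbf{a})=\frac{\det\big(x_i(x_i|\mathbf{a})^{\lambda_j+n-j}-\overline{x}_i(\overline{x}_i|\mathbf{a})^{\lambda_j+n-j}\big)}{\det\big(x_i(x_i|\mathbf{a})^{n-j}-\overline{x}_i(\overline{x}_i|\mathbf{a})^{n-j}\big)},$$ $$so_\lambda(\mathbf{x},\overline{\mathbf{x}},1|\mathbf{a})=\frac{\det\big(x_i^{1/2}(x_i|\mathbf{a})^{\lambda_j+n-j}-\overline{x}_i^{1/2}(\overline{x}_i|\mathbf{a})^{\lambda_j+n-j}\big)}{\det\big(x_i^{1/2}(x_i|\mathbf{a})^{n-j}-\overline{x}_i^{1/2}(\overline{x}_i|\mathbf{a})^{n-j}\big)}.$$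 Factorial complete functions: for a list $\mathbf{u}=(u_1,\ldots,u_r)$ of $r\ge1$ variables, $\overline{\mathbf{u}}=(u_1^{ -1},\ldots,u_r^{ -1})$, and $m\ge0$, with $[t^m]F$ denoting the coefficient of $t^m$ in the power series expansion of $F$ in $t$, $$h_m(\mathbf{u}|\mathbf{a})=[t^m]\prod_{i=1}^r\frac{1}{1-tu_i}\prod_{j=1}^{r+m-1}(1+ta_j),$$ $$h^{sp}_m(\mathbf{u},\overline{\mathbf{u}}|\mathbf{a})=[t^m]\prod_{i=1}^r\frac{1}{(1-tu_i)(1-tu_i^{ -1})}\prod_{j=1}^{r+m-1}(1+ta_j),$$ $$h^{so}_m(\mathbf{u},\overline{\mathbf{u}},1|\mathbf{a})=[t^m]\,(1+t)\prod_{i=1}^r\frac{1}{(1-tu_i)(1-tu_i^{ -1})}\prod_{j=1}^{r+m-1}(1+ta_j).$$ All three equal $1$ for $m=0$ and are set equal to $0$ for $m<0$. Note that the number $r$ of variables in the list (here $r=n-i+1$ for $\mathbf{x}^{(i)}$) enters the upper limit of the last product. -}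

module Defs where

open import Algebra.Apartness.Bundles using (HeytingField; HeytingCommutativeRing)
open import Algebra.Bundles using (CommutativeRing)
open import Data.Fin.Base using (Fin; zero; suc; toℕ; punchIn)
open import Data.Integer.Base using (ℤ; +_; -[1+_])
open import Data.List.Base using (List; []; _∷_; length; foldr; map; zipWith; applyUpTo; tabulate; drop)
open import Data.Nat.Base as ℕ using (ℕ; zero; suc; _∸_)
open import Data.Product.Base using (proj₁)
open import Level using (_⊔_)
open import Relation.Binary.PropositionalEquality.Core using (_≢_)

module Factorial {c ℓ₁ ℓ₂} (K : HeytingField c ℓ₁ ℓ₂) where

  open HeytingField K hiding (zero)
  private
    module R = CommutativeRing (HeytingCommutativeRing.commutativeRing heytingCommutativeRing)
  open import Algebra.Properties.Semiring.Exp R.semiring using (_^_)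
  open import Algebra.Properties.Semiring.Sum R.semiring using (sum-syntax; sum⁺-syntax)
  open import Algebra.Apartness.Properties.HeytingCommutativeRing heytingCommutativeRing
    using (x#0y#0→xy#0)

  -- #⇒invertible p inverts z - 0#, which is equal to z.
  inv : (z : Carrier) → z # 0# → Carrier
  inv z p = proj₁ (#⇒invertible p)

  _/_[_] : (p q : Carrier) → q # 0# → Carrier
  p / q [ q#0 ] = p * inv q q#0

  Matrix : ℕ → Set c
  Matrix n = Fin n → Fin n → Carrier

  -- Laplace expansion along the first column.
  det : ∀ {n} → Matrix n → Carrier
  det {zero}  M = 1#
  det {suc n} M =
    ∑[ i < suc n ] ((- 1#) ^ toℕ i * M i zero * det (λ k l → M (punchIn i k) (suc l)))

  -- A formal power series in t, given by its coefficients.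
  Series : Set c
  Series = ℕ → Carrier

  1ₛ : Series
  1ₛ zero    = 1#
  1ₛ (suc _) = 0#

  infixl 7 _⊛_
  _⊛_ : Series → Series → Series
  (f ⊛ g) m = ∑[ k ≤ m ] (f (toℕ k) * g (m ∸ toℕ k))

  ∏ₛ : List Series → Series
  ∏ₛ = foldr _⊛_ 1ₛ

  1+t_ : Carrier → Series
  (1+t u) 0 = 1#
  (1+t u) 1 = u
  (1+t u) (suc (suc _)) = 0#

  -- The geometric series.
  1/[1-t_] : Carrier → Series
  1/[1-t u ] m = u ^ m

  -- The parameters are indexed from 0: a j stands for a_{j+1}.
  Parameters : Set c
  Parameters = ℕ → Carrier

  -- (z | a)^m
  [_∣_]^_ : Carrier → Parameters → ℕ → Carrier
  [ z ∣ a ]^ zero  = 1#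
  [ z ∣ a ]^ suc m = [ z ∣ a ]^ m * (z + a m)

  -- ∏_{j=1}^{N} (1 + t a_j)
  ∏[1+t_] : Parameters → ℕ → Series
  ∏[1+t a ] N = ∏ₛ (applyUpTo (λ j → 1+t a j) N)

  -- The truncated subtraction in the upper limit r + m - 1 is the true one,
  -- as the lists of variables are nonempty.
  h : ℤ → List Carrier → Parameters → Carrier
  h (+ m)    us a = (∏ₛ (map 1/[1-t_] us) ⊛ ∏[1+t a ] (length us ℕ.+ m ∸ 1)) m
  h -[1+ _ ] us a = 0#

  -- In hˢᵖ and hˢᵒ the second list consists of the inverses of the first.
  hˢᵖ : ℤ → (us ūs : List Carrier) → Parameters → Carrier
  hˢᵖ (+ m)    us ūs a =
    (∏ₛ (zipWith (λ u ū → 1/[1-t u ] ⊛ 1/[1-t ū ]) us ūs)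
      ⊛ ∏[1+t a ] (length us ℕ.+ m ∸ 1)) m
  hˢᵖ -[1+ _ ] us ūs a = 0#

  hˢᵒ : ℤ → (us ūs : List Carrier) → Parameters → Carrier
  hˢᵒ (+ m)    us ūs a =
    ((1+t 1#) ⊛ ∏ₛ (zipWith (λ u ū → 1/[1-t u ] ⊛ 1/[1-t ū ]) us ūs)
      ⊛ ∏[1+t a ] (length us ℕ.+ m ∸ 1)) m
  hˢᵒ -[1+ _ ] us ūs a = 0#

  -- Values in K for the indeterminates x_i^{1/2}.  The last two fields are what
  -- makes the three denominators nonzero; taking for K a field of rational
  -- functions in the x_i^{1/2} (and, if wanted, the a_j), the generators
  -- themselves satisfy all of them, so identities between rational functions
  -- are the instance in which the x_i are indeterminates.
  record Variables (n : ℕ) : Set (c ⊔ ℓ₂) where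
    field
      x½   : Fin n → Carrier
      x½#0 : ∀ i → x½ i # 0#

    x : Fin n → Carrier
    x i = x½ i * x½ i

    field
      xᵢ#xⱼ  : ∀ {i j} → i ≢ j → x i # x j
      xᵢxⱼ#1 : ∀ i j → x i * x j # 1#

    x̄½ : Fin n → Carrier
    x̄½ i = inv (x½ i) (x½#0 i)

    x̄ : Fin n → Carrier
    x̄ i = inv (x i) (x#0y#0→xy#0 (x½#0 i) (x½#0 i))

  -- The list (z_i , … , z_n); here i is counted from 0.
  _from_ : ∀ {n} → (Fin n → Carrier) → Fin n → List Carrier
  z from i = drop (toℕ i) (tabulate z)

  -- With j counted from 0, the exponent λ_j + n - j becomes
  -- λ_j + (n ∸ suc j).
  module Characters {n} (X : Variables n) (a : Parameters) where
    open Variables X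

    exponent : (Fin n → ℕ) → Fin n → ℕ
    exponent l j = l j ℕ.+ (n ∸ suc (toℕ j))

    ∅ : Fin n → ℕ
    ∅ _ = 0

    s-alternant : (Fin n → ℕ) → Carrier
    s-alternant l = det {n} λ i j → [ x i ∣ a ]^ exponent l j

    sp-alternant : (Fin n → ℕ) → Carrier
    sp-alternant l = det {n} λ i j →
      x i * [ x i ∣ a ]^ exponent l j - x̄ i * [ x̄ i ∣ a ]^ exponent l j

    so-alternant : (Fin n → ℕ) → Carrier
    so-alternant l = det {n} λ i j →
      x½ i * [ x i ∣ a ]^ exponent l j - x̄½ i * [ x̄ i ∣ a ]^ exponent l j

    s : (Fin n → ℕ) → s-alternant ∅ # 0# → Carrier
    s l d = s-alternant l / s-alternant ∅ [ d ]

    sp : (Fin n → ℕ) → sp-alternant ∅ # 0# → Carrier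
    sp l d = sp-alternant l / sp-alternant ∅ [ d ]

    so : (Fin n → ℕ) → so-alternant ∅ # 0# → Carrier
    so l d = so-alternant l / so-alternant ∅ [ d ]

{-# OPTIONS --safe #-}

-- The alternant entries are p_i [t^m] q_i(t) B_m(t), where q_i is 1/(1 - t x_i),
-- respectively 1/((1 - t x_i)(1 - t x_i⁻¹)), and B_m is ∏_{j≤m} (1 + t a_j), times
-- 1 + t in the odd orthogonal case.  Since
--   q_i - q_k = (y_i - y_k) t q_i q_k    with y = x, respectively y = x + x⁻¹,
-- the series t^{n-i} q_i ⋯ q_n are the divided differences of the q's with respect
-- to the nodes y, and Newton's interpolation formula expresses p_i q_i through them
-- by an upper triangular matrix with diagonal p_i ∏_{k>i} (y_i - y_k).  As det is
-- alternating, every alternant is the same scalar times the corresponding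
-- determinant of complete functions.  For λ = ∅ that determinant is lower
-- unitriangular, so the scalar is the denominator.

module Submission where

open import Defs
open import Algebra.Apartness.Bundles using (HeytingField; HeytingCommutativeRing)
import Algebra.Apartness.Properties.HeytingCommutativeRing
open import Algebra.Bundles using (CommutativeRing)
import Algebra.Construct.Pointwise as Pointwise
import Algebra.Properties.CommutativeSemigroup
import Algebra.Properties.Ring
import Algebra.Properties.Semiring.Exp
import Algebra.Properties.Semiring.Mult.TCOptimised
import Algebra.Properties.Semiring.Sum
import Algebra.Solver.Ring
open import Algebra.Solver.Ring.AlmostCommutativeRing
  using (fromCommutativeRing; _-Raw-AlmostCommutative⟶_)
open import Data.Fin.Base as Fin using (Fin; zero; suc; toℕ; punchIn; punchOut)
import Data.Fin.Properties as Fin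
open import Data.Integer.Base as ℤ using (ℤ; +_; -[1+_])
import Data.Integer.Properties as ℤ
open import Data.List.Base as List
  using (_∷ʳ_; tabulate; drop; applyUpTo; map; zipWith; length)
import Data.List.Properties as List
open import Data.Maybe.Base as Maybe using (Maybe)
open import Data.Nat.Base as ℕ using (ℕ; NonZero; zero; suc; z≤n; s≤s; _∸_)
import Data.Nat.Properties as ℕ
open import Data.Product.Base using (Σ-syntax; _×_; _,_; proj₁; proj₂)
open import Data.Sum.Base as Sum using (_⊎_; inj₁; inj₂)
open import Data.Vec.Functional using (_∷_; head; tail; foldr)
open import Function.Base using (_∘_)
open import Level using (_⊔_)
open import Relation.Binary.Consequences using (dec⇒weaklyDec)
open import Relation.Binary.Core using (_Preserves_⟶_)
open import Relation.Binary.PropositionalEquality as ≡ using (_≡_; _≢_)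
import Relation.Binary.Reasoning.Setoid
open import Relation.Nullary using (yes; no; contradiction)

-- A ring solver with integer coefficients

-- The obstacle is that B_m changes with the column, while a row operation must act on all columns
-- at once. Hence a row is taken to be a whole series f, and column j is the linear functional
-- sending f to [t^e] f B_e with e = λ_j + n - j. The complete functions fit this pattern. The list
-- x^(i) has r = n - i + 1 variables, and in degree m = λ_j - j + i the upper limit r + m - 1 equals
-- e, which does not depend on the row. The power t^{n-i} bridges the gap between m and e, and the
-- convention that negative degrees give 0 becomes the vanishing of coefficients below that power.
-- The relation between q_i and q_k holds because 1/q_i + t y_i is one and the same series for all
-- i, namely 1, respectively 1 + t². In a Heyting field a quotient requires its denominator to be
-- apart from 0; this comes out of the evaluation of the denominator as a product of elements apart
-- from 0.

module IntegerCoefficients {c ℓ} (R : CommutativeRing c ℓ) where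
  open CommutativeRing R
  open Algebra.Properties.Ring ring
    using (-0#≈0#; -‿involutive; -‿+-comm; -‿distribˡ-*; -‿distribʳ-*)
  open Algebra.Properties.Semiring.Mult.TCOptimised semiring using (1+×; ×-homo-+; ×1-homo-*)
    renaming (_×_ to _•_)
  open Relation.Binary.Reasoning.Setoid setoid

  ⟦_⟧ : ℤ → Carrier
  ⟦ + n ⟧      = n • 1#
  ⟦ -[1+ n ] ⟧ = - (suc n • 1#)

  neg-homo : ∀ i → ⟦ ℤ.- i ⟧ ≈ - ⟦ i ⟧
  neg-homo (+ zero)  = sym -0#≈0#
  neg-homo (+ suc n) = refl
  neg-homo -[1+ n ]  = sym (-‿involutive _)

  ⊖-homo : ∀ m n → ⟦ m ℤ.⊖ n ⟧ ≈ m • 1# - n • 1#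
  ⊖-homo zero    zero    = sym (-‿inverseʳ 0#)
  ⊖-homo zero    (suc n) = sym (+-identityˡ _)
  ⊖-homo (suc m) zero    = sym (trans (+-congˡ -0#≈0#) (+-identityʳ _))
  ⊖-homo (suc m) (suc n) = begin
    ⟦ suc m ℤ.⊖ suc n ⟧                ≡⟨ ≡.cong ⟦_⟧ (ℤ.[1+m]⊖[1+n]≡m⊖n m n) ⟩
    ⟦ m ℤ.⊖ n ⟧                        ≈⟨ ⊖-homo m n ⟩
    x - y                              ≈⟨ +-congʳ (+-identityʳ x) ⟨
    x + 0# - y                         ≈⟨ +-congʳ (+-congˡ (-‿inverseʳ 1#)) ⟨
    x + (1# - 1#) - y                  ≈⟨ +-congʳ (+-assoc x 1# (- 1#)) ⟨
    x + 1# - 1# - y                    ≈⟨ +-assoc (x + 1#) (- 1#) (- y) ⟩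
    x + 1# + (- 1# - y)                ≈⟨ +-cong (+-comm x 1#) (-‿+-comm 1# y) ⟩
    1# + x - (1# + y)                  ≈⟨ +-cong (1+× m 1#) (-‿cong (1+× n 1#)) ⟨
    suc m • 1# - suc n • 1#            ∎
    where
    x = m • 1#
    y = n • 1#

  +-homo : ∀ i j → ⟦ i ℤ.+ j ⟧ ≈ ⟦ i ⟧ + ⟦ j ⟧
  +-homo (+ m)    (+ n)    = ×-homo-+ 1# m n
  +-homo (+ m)    -[1+ n ] = ⊖-homo m (suc n)
  +-homo -[1+ m ] (+ n)    = trans (⊖-homo n (suc m)) (+-comm _ _)
  +-homo -[1+ m ] -[1+ n ] = begin
    ⟦ ℤ.- + suc m ℤ.- + suc n ⟧          ≡⟨ ≡.cong ⟦_⟧ (ℤ.neg-distrib-+ (+ suc m) (+ suc n)) ⟨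
    ⟦ ℤ.- (+ suc m ℤ.+ + suc n) ⟧        ≈⟨ neg-homo (+ suc m ℤ.+ + suc n) ⟩
    - ⟦ + suc m ℤ.+ + suc n ⟧            ≈⟨ -‿cong (×-homo-+ 1# (suc m) (suc n)) ⟩
    - (suc m • 1# + suc n • 1#)          ≈⟨ -‿+-comm _ _ ⟨
    - (suc m • 1#) - suc n • 1#          ∎

  *-homo⁺ : ∀ m j → ⟦ + m ℤ.* j ⟧ ≈ m • 1# * ⟦ j ⟧
  *-homo⁺ m (+ n)    = trans (reflexive (≡.cong ⟦_⟧ (≡.sym (ℤ.pos-* m n)))) (×1-homo-* m n)
  *-homo⁺ m -[1+ n ] = begin
    ⟦ + m ℤ.* ℤ.- + suc n ⟧          ≡⟨ ≡.cong ⟦_⟧ (ℤ.neg-distribʳ-* (+ m) (+ suc n)) ⟨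
    ⟦ ℤ.- (+ m ℤ.* + suc n) ⟧        ≈⟨ neg-homo (+ m ℤ.* + suc n) ⟩
    - ⟦ + m ℤ.* + suc n ⟧            ≈⟨ -‿cong (*-homo⁺ m (+ suc n)) ⟩
    - (m • 1# * (suc n • 1#))        ≈⟨ -‿distribʳ-* _ _ ⟩
    m • 1# * - (suc n • 1#)          ∎

  *-homo : ∀ i j → ⟦ i ℤ.* j ⟧ ≈ ⟦ i ⟧ * ⟦ j ⟧
  *-homo (+ m)    j = *-homo⁺ m j
  *-homo -[1+ m ] j = begin
    ⟦ ℤ.- + suc m ℤ.* j ⟧            ≡⟨ ≡.cong ⟦_⟧ (ℤ.neg-distribˡ-* (+ suc m) j) ⟨
    ⟦ ℤ.- (+ suc m ℤ.* j) ⟧          ≈⟨ neg-homo (+ suc m ℤ.* j) ⟩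
    - ⟦ + suc m ℤ.* j ⟧              ≈⟨ -‿cong (*-homo⁺ (suc m) j) ⟩
    - (suc m • 1# * ⟦ j ⟧)           ≈⟨ -‿distribˡ-* _ _ ⟩
    - (suc m • 1#) * ⟦ j ⟧           ∎

  morphism : ℤ.+-*-rawRing -Raw-AlmostCommutative⟶ fromCommutativeRing R
  morphism = record
    { ⟦_⟧    = ⟦_⟧
    ; +-homo = +-homo
    ; *-homo = *-homo
    ; -‿homo = neg-homo
    ; 0-homo = refl
    ; 1-homo = refl
    }

  -- Equality in the ring need not be decidable, but that of integer coefficients is. Distinct
  -- integers may have equal images, so only a positive answer is transported.
  _≈?_ : ∀ i j → Maybe (⟦ i ⟧ ≈ ⟦ j ⟧)
  i ≈? j = Maybe.map (λ eq → reflexive (≡.cong ⟦_⟧ eq)) (dec⇒weaklyDec ℤ._≟_ i j)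

  open Algebra.Solver.Ring ℤ.+-*-rawRing (fromCommutativeRing R) morphism _≈?_ public
    using (solve; _:+_; _:*_; _:-_; _:=_; con)

-- Determinants as alternating multilinear functions of the rows

-- The enumerations that skip `i` and skip its successor `k` differ in a single place, where one
-- passes through `k` and the other through `i`. If those two rows are equal, both deletions
-- therefore leave the same minor.
punchIn-adjacent : ∀ {n} {i k : Fin (suc n)} → toℕ k ≡ suc (toℕ i) → ∀ l →
                   punchIn i l ≡ punchIn k l ⊎ (punchIn i l ≡ k × punchIn k l ≡ i)
punchIn-adjacent {i = zero}  {suc zero} eq zero    = inj₂ (≡.refl , ≡.refl)
punchIn-adjacent {i = zero}  {suc zero} eq (suc l) = inj₁ ≡.refl
punchIn-adjacent {i = suc i} {suc k}    eq zero    = inj₁ ≡.refl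
punchIn-adjacent {i = suc i} {suc k}    eq (suc l) =
  Sum.map (≡.cong suc) (λ (p , q) → ≡.cong suc p , ≡.cong suc q)
    (punchIn-adjacent (ℕ.suc-injective eq) l)

-- No index lies strictly between two neighbours, so deleting a third one keeps them adjacent; this
-- carries the induction to minors.
punchOut-adjacent : ∀ {n} {p i k : Fin (suc n)} (p≢i : p ≢ i) (p≢k : p ≢ k) →
                    toℕ k ≡ suc (toℕ i) → toℕ (punchOut p≢k) ≡ suc (toℕ (punchOut p≢i))
punchOut-adjacent {_}     {zero}        {zero}  {_}        p≢i _   _  = contradiction ≡.refl p≢i
punchOut-adjacent {_}     {zero}        {suc i} {suc k}    _   _   eq = ℕ.suc-injective eq
punchOut-adjacent {suc n} {suc zero}    {zero}  {suc zero} _   p≢k _  = contradiction ≡.refl p≢k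
punchOut-adjacent {suc (suc n)} {suc (suc p)} {zero}  {suc zero} _   _   _  = ≡.refl
punchOut-adjacent {suc n} {suc p}       {suc i} {suc k}    p≢i p≢k eq =
  ≡.cong suc (punchOut-adjacent (p≢i ∘ ≡.cong suc) (p≢k ∘ ≡.cong suc) (ℕ.suc-injective eq))

module Determinants {c ℓ₁ ℓ₂} (K : HeytingField c ℓ₁ ℓ₂) where
  open HeytingField K hiding (zero)
  open Factorial K
  R = HeytingCommutativeRing.commutativeRing heytingCommutativeRing
  module R = CommutativeRing R
  open Algebra.Properties.Semiring.Exp R.semiring using (_^_)
  open Algebra.Properties.Semiring.Sum R.semiring
    using (sum; sum-cong-≋; ∑-distrib-+; *-distribˡ-sum; sum-replicate-zero)
  open Algebra.Properties.Ring R.ring using (-1*x≈-x)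
  module * = Algebra.Properties.CommutativeSemigroup R.*-commutativeSemigroup
  open Relation.Binary.Reasoning.Setoid R.setoid

  product : ∀ {n} → (Fin n → Carrier) → Carrier
  product = foldr _*_ 1#

  sum-zero : ∀ {n} {f : Fin n → Carrier} → (∀ i → f i ≈ 0#) → sum f ≈ 0#
  sum-zero {n} f≈0 = trans (sum-cong-≋ f≈0) (sum-replicate-zero n)

  sum-adjacent-cancel : ∀ {n} {f : Fin n → Carrier} {i k} → toℕ k ≡ suc (toℕ i) →
                        f i + f k ≈ 0# → (∀ p → p ≢ i → p ≢ k → f p ≈ 0#) → sum f ≈ 0#
  sum-adjacent-cancel {suc (suc n)} {f} {zero} {suc zero} _ f₀+f₁≈0 f≈0 = begin
    f zero + (f (suc zero) + sum rest)  ≈⟨ +-assoc _ _ _ ⟨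
    f zero + f (suc zero) + sum rest    ≈⟨ +-cong f₀+f₁≈0 (sum-zero λ p → f≈0 (suc (suc p)) (λ ()) (λ ())) ⟩
    0# + 0#                             ≈⟨ +-identityˡ 0# ⟩
    0#                                  ∎
    where rest = λ p → f (suc (suc p))
  sum-adjacent-cancel {suc n} {f} {suc i} {suc k} eq fᵢ+fₖ≈0 f≈0 = begin
    f zero + sum (f ∘ suc)  ≈⟨ +-cong (f≈0 zero (λ ()) (λ ()))
                                 (sum-adjacent-cancel (ℕ.suc-injective eq) fᵢ+fₖ≈0
                                   λ p p≢i p≢k → f≈0 (suc p) (p≢i ∘ Fin.suc-injective) (p≢k ∘ Fin.suc-injective)) ⟩
    0# + 0#                 ≈⟨ +-identityˡ 0# ⟩
    0#                      ∎
  
  -- The index set `I` of a row is arbitrary because the forms are later applied to rows that are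
  -- power series. Only neighbouring equal rows are mentioned, as this is what the Laplace expansion
  -- yields directly; other pairs follow in `alternating-equalRows`. Additivity and homogeneity are
  -- merged in `linear`.
  record Alternating {i} {I : Set i} {n} (F : (Fin n → I → Carrier) → Carrier) : Set (c ⊔ ℓ₁ ⊔ i) where
    field
      congruent : ∀ {A B} → (∀ i j → A i j ≈ B i j) → F A ≈ F B
      linear    : ∀ i a {A B C} → (∀ j → A i j ≈ a * B i j + C i j) →
                  (∀ k → k ≢ i → ∀ j → A k j ≈ B k j) →
                  (∀ k → k ≢ i → ∀ j → A k j ≈ C k j) →
                  F A ≈ a * F B + F C
      adjacent  : ∀ {i k A} → toℕ k ≡ suc (toℕ i) → (∀ j → A i j ≈ A k j) → F A ≈ 0#

  open Alternating

  det-cong : ∀ {n} {A B : Matrix n} → (∀ i j → A i j ≈ B i j) → det A ≈ det B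
  det-cong {zero}  A≈B = refl
  det-cong {suc n} A≈B = sum-cong-≋ λ i →
    *-cong (*-congˡ {x = (- 1#) ^ toℕ i} (A≈B i zero)) (det-cong λ k l → A≈B (punchIn i k) (suc l))

  -- Each term of the expansion meets row `i` exactly once: through its entry if `p` is `i`, through
  -- its minor otherwise.
  det-linear : ∀ {n} i a {A B C : Matrix n} → (∀ j → A i j ≈ a * B i j + C i j) →
               (∀ k → k ≢ i → ∀ j → A k j ≈ B k j) →
               (∀ k → k ≢ i → ∀ j → A k j ≈ C k j) →
               det A ≈ a * det B + det C
  det-linear {suc n} i a {A} {B} {C} Aᵢ A≈B A≈C = begin
    sum (term A)                                  ≈⟨ sum-cong-≋ expand ⟩
    sum (λ p → a * term B p + term C p)           ≈⟨ ∑-distrib-+ (λ p → a * term B p) (term C) ⟩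
    sum (λ p → a * term B p) + sum (term C)       ≈⟨ +-congʳ (*-distribˡ-sum a (term B)) ⟨
    a * sum (term B) + sum (term C)               ∎
    where
    minor : Matrix (suc n) → Fin (suc n) → Matrix n
    minor M p k l = M (punchIn p k) (suc l)
    term : Matrix (suc n) → Fin (suc n) → Carrier
    term M p = (- 1#) ^ toℕ p * M p zero * det (minor M p)
    expand : ∀ p → term A p ≈ a * term B p + term C p
    expand p with p Fin.≟ i
    ... | yes ≡.refl = begin
      σ * A p zero * det (minor A p)                      ≈⟨ *-congʳ (*-congˡ (Aᵢ zero)) ⟩
      σ * (a * B p zero + C p zero) * det (minor A p)     ≈⟨ *-congʳ (distribˡ σ _ _) ⟩
      (σ * (a * B p zero) + σ * C p zero) * det (minor A p)
        ≈⟨ distribʳ _ _ _ ⟩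
      σ * (a * B p zero) * det (minor A p) + σ * C p zero * det (minor A p)
        ≈⟨ +-cong (*-cong (*.x∙yz≈y∙xz σ a (B p zero)) (det-cong λ k l → A≈B (punchIn p k) (Fin.punchInᵢ≢i p k) (suc l)))
                  (*-congˡ (det-cong λ k l → A≈C (punchIn p k) (Fin.punchInᵢ≢i p k) (suc l))) ⟩
      a * (σ * B p zero) * det (minor B p) + term C p     ≈⟨ +-congʳ (*-assoc a _ _) ⟩
      a * term B p + term C p                             ∎
      where σ = (- 1#) ^ toℕ p
    ... | no p≢i = begin
      σ * A p zero * det (minor A p)                      ≈⟨ *-congˡ IH ⟩
      σ * A p zero * (a * det (minor B p) + det (minor C p))
        ≈⟨ distribˡ _ _ _ ⟩
      σ * A p zero * (a * det (minor B p)) + σ * A p zero * det (minor C p)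
        ≈⟨ +-cong (*.x∙yz≈y∙xz _ a _) (*-congʳ (*-congˡ (A≈C p p≢i zero))) ⟩
      a * (σ * A p zero * det (minor B p)) + term C p
        ≈⟨ +-congʳ (*-congˡ (*-congʳ (*-congˡ (A≈B p p≢i zero)))) ⟩
      a * term B p + term C p                             ∎
      where
      σ = (- 1#) ^ toℕ p
      r = punchOut p≢i
      r≡i : punchIn p r ≡ i
      r≡i = Fin.punchIn-punchOut p≢i
      off : ∀ {k} → k ≢ r → punchIn p k ≢ i
      off k≢r eq = k≢r (Fin.punchIn-injective p _ _ (≡.trans eq (≡.sym r≡i)))
      IH = det-linear r a {minor A p} {minor B p} {minor C p}
        (λ l → ≡.subst (λ e → A e (suc l) ≈ a * B e (suc l) + C e (suc l)) (≡.sym r≡i) (Aᵢ (suc l)))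
        (λ k k≢r l → A≈B (punchIn p k) (off k≢r) (suc l))
        (λ k k≢r l → A≈C (punchIn p k) (off k≢r) (suc l))

  -- The terms at `i` and `k` have equal entries, equal minors and opposite signs. Every other minor
  -- still contains both rows, as neighbours, and vanishes by induction.
  det-adjacent : ∀ {n i k} {A : Matrix n} → toℕ k ≡ suc (toℕ i) →
                 (∀ j → A i j ≈ A k j) → det A ≈ 0#
  det-adjacent {suc n} {i} {k} {A} eq Aᵢ≈Aₖ = sum-adjacent-cancel eq cancel vanish
    where
    σ = (- 1#) ^ toℕ i
    minor : Fin (suc n) → Matrix n
    minor p k l = A (punchIn p k) (suc l)
    minors≈ : ∀ l j → A (punchIn i l) j ≈ A (punchIn k l) j
    minors≈ l j with punchIn-adjacent {i = i} {k} eq l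
    ... | inj₁ e        = reflexive (≡.cong (λ p → A p j) e)
    ... | inj₂ (e , e′) = begin
      A (punchIn i l) j ≡⟨ ≡.cong (λ p → A p j) e ⟩
      A k j             ≈⟨ Aᵢ≈Aₖ j ⟨
      A i j             ≡⟨ ≡.cong (λ p → A p j) e′ ⟨
      A (punchIn k l) j ∎
    cancel : (- 1#) ^ toℕ i * A i zero * det (minor i) + (- 1#) ^ toℕ k * A k zero * det (minor k) ≈ 0#
    cancel = begin
      σ * A i zero * det (minor i) + (- 1#) ^ toℕ k * A k zero * det (minor k)
        ≈⟨ +-cong (*-cong (*-congˡ (Aᵢ≈Aₖ zero)) (det-cong λ l j → minors≈ l (suc j)))
                  (reflexive (≡.cong (λ e → (- 1#) ^ e * A k zero * det (minor k)) eq)) ⟩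
      σ * A k zero * det (minor k) + (- 1# * σ) * A k zero * det (minor k)
        ≈⟨ +-congˡ (trans (*-congʳ (*-assoc _ _ _)) (*-assoc _ _ _)) ⟩
      σ * A k zero * det (minor k) + - 1# * (σ * A k zero * det (minor k))
        ≈⟨ +-congˡ (-1*x≈-x _) ⟩
      σ * A k zero * det (minor k) - σ * A k zero * det (minor k)
        ≈⟨ -‿inverseʳ _ ⟩
      0# ∎
    vanish : ∀ p → p ≢ i → p ≢ k → (- 1#) ^ toℕ p * A p zero * det (minor p) ≈ 0#
    vanish p p≢i p≢k = trans (*-congˡ (det-adjacent {A = minor p} (punchOut-adjacent p≢i p≢k eq) rows≈)) (zeroʳ _)
      where
      rows≈ : ∀ l → minor p (punchOut p≢i) l ≈ minor p (punchOut p≢k) l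
      rows≈ l = begin
        A (punchIn p (punchOut p≢i)) (suc l) ≡⟨ ≡.cong (λ e → A e (suc l)) (Fin.punchIn-punchOut p≢i) ⟩
        A i (suc l)                          ≈⟨ Aᵢ≈Aₖ (suc l) ⟩
        A k (suc l)                          ≡⟨ ≡.cong (λ e → A e (suc l)) (Fin.punchIn-punchOut p≢k) ⟨
        A (punchIn p (punchOut p≢k)) (suc l) ∎

  -- Row operations on alternating forms

  module _ {i} {I : Set i} where

    ∷-cong : ∀ {n} {v w : I → Carrier} {A B : Fin n → I → Carrier} →
             (∀ j → v j ≈ w j) → (∀ i j → A i j ≈ B i j) → ∀ i j → (v ∷ A) i j ≈ (w ∷ B) i j
    ∷-cong v≈w A≈B zero    = v≈w
    ∷-cong v≈w A≈B (suc i) = A≈B i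

    head∷tail : ∀ {n} (A : Fin (suc n) → I → Carrier) → ∀ i j → A i j ≈ (head A ∷ tail A) i j
    head∷tail A zero    j = refl
    head∷tail A (suc i) j = refl

    alternating-tail : ∀ {n} {F : (Fin (suc n) → I → Carrier) → Carrier} → Alternating F →
                       ∀ v → Alternating (λ A → F (v ∷ A))
    alternating-tail alt v = record
      { congruent = λ A≈B → congruent alt (∷-cong (λ _ → refl) A≈B)
      ; linear    = λ i a Aᵢ A≈B A≈C → linear alt (suc i) a Aᵢ (off A≈B) (off A≈C)
      ; adjacent  = λ eq Aᵢ≈Aₖ → adjacent alt (≡.cong suc eq) Aᵢ≈Aₖ
      }
      where
      off : ∀ {n} {A B : Fin n → I → Carrier} {i} → (∀ k → k ≢ i → ∀ j → A k j ≈ B k j) →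
            ∀ k → k ≢ suc i → ∀ j → (v ∷ A) k j ≈ (v ∷ B) k j
      off A≈B zero    _   j = refl
      off A≈B (suc k) k≢i j = A≈B k (k≢i ∘ ≡.cong suc) j

    linear-head : ∀ {n} {F : (Fin (suc n) → I → Carrier) → Carrier} → Alternating F →
                  ∀ a {u v w} {A : Fin n → I → Carrier} → (∀ j → u j ≈ a * v j + w j) →
                  F (u ∷ A) ≈ a * F (v ∷ A) + F (w ∷ A)
    linear-head alt a {u} {v} {w} {A} u≈ = linear alt zero a u≈ off off
      where
      off : ∀ {v} k → k ≢ zero → ∀ j → (u ∷ A) k j ≈ (v ∷ A) k j
      off zero    0≢0 j = contradiction ≡.refl 0≢0
      off (suc k) _   j = refl

    -- Polarisation: expand the form with `u + v` in both of the first two places. Only the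
    -- vanishing is transported, which spares the bookkeeping of signs.
    alternating-swap : ∀ {n} {F : (Fin (suc (suc n)) → I → Carrier) → Carrier} → Alternating F →
                       ∀ u v (A : Fin n → I → Carrier) → F (v ∷ u ∷ A) ≈ 0# → F (u ∷ v ∷ A) ≈ 0#
    alternating-swap {F = F} alt u v A Fvu≈0 = begin
      F (u ∷ v ∷ A)                               ≈⟨ +-identityʳ _ ⟨
      F (u ∷ v ∷ A) + 0#                          ≈⟨ +-cong Fuv≈ Fvs≈0 ⟨
      1# * F (u ∷ s ∷ A) + F (v ∷ s ∷ A)          ≈⟨ linear-head alt 1# (λ j → +-congʳ (sym (*-identityˡ (u j)))) ⟨
      F (s ∷ s ∷ A)                               ≈⟨ diagonal s ⟩
      0#                                          ∎
      where
      s = λ j → u j + v j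
      diagonal : ∀ w → F (w ∷ w ∷ A) ≈ 0#
      diagonal w = adjacent alt {zero} {suc zero} ≡.refl λ _ → refl
      expand : ∀ w → F (w ∷ s ∷ A) ≈ 1# * F (w ∷ u ∷ A) + F (w ∷ v ∷ A)
      expand w = linear-head (alternating-tail alt w) 1# (λ j → +-congʳ (sym (*-identityˡ (u j))))
      Fuv≈ : 1# * F (u ∷ s ∷ A) ≈ F (u ∷ v ∷ A)
      Fuv≈ = begin
        1# * F (u ∷ s ∷ A)                      ≈⟨ *-identityˡ _ ⟩
        F (u ∷ s ∷ A)                           ≈⟨ expand u ⟩
        1# * F (u ∷ u ∷ A) + F (u ∷ v ∷ A)      ≈⟨ +-congʳ (trans (*-congˡ (diagonal u)) (zeroʳ 1#)) ⟩
        0# + F (u ∷ v ∷ A)                      ≈⟨ +-identityˡ _ ⟩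
        F (u ∷ v ∷ A)                           ∎
      Fvs≈0 : F (v ∷ s ∷ A) ≈ 0#
      Fvs≈0 = begin
        F (v ∷ s ∷ A)                           ≈⟨ expand v ⟩
        1# * F (v ∷ u ∷ A) + F (v ∷ v ∷ A)      ≈⟨ +-cong (trans (*-congˡ Fvu≈0) (zeroʳ 1#)) (diagonal v) ⟩
        0# + 0#                                 ≈⟨ +-identityˡ 0# ⟩
        0#                                      ∎

    -- Exchanging the first two rows moves row zero one place closer to its copy; the new first row
    -- is then frozen by `alternating-tail`, and the distance has dropped by one.
    alternating-equalRows : ∀ {n} {F : (Fin n → I → Carrier) → Carrier} → Alternating F →
                            ∀ {i k} → i Fin.< k → ∀ {A} → (∀ j → A i j ≈ A k j) → F A ≈ 0#
    alternating-equalRows alt {zero} {suc zero} i<k Aᵢ≈Aₖ = adjacent alt ≡.refl Aᵢ≈Aₖ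
    alternating-equalRows {F = F} alt {zero} {suc (suc k)} i<k {A} Aᵢ≈Aₖ = begin
      F A           ≈⟨ congruent alt split ⟩
      F (u ∷ v ∷ B) ≈⟨ alternating-swap alt u v B
                         (alternating-equalRows (alternating-tail alt v) {zero} {suc k} (s≤s z≤n) Aᵢ≈Aₖ) ⟩
      0#            ∎
      where
      u = A zero
      v = A (suc zero)
      B = λ i → A (suc (suc i))
      split : ∀ i j → A i j ≈ (u ∷ v ∷ B) i j
      split zero          j = refl
      split (suc zero)    j = refl
      split (suc (suc i)) j = refl
    alternating-equalRows alt {suc i} {suc k} (s≤s i<k) {A} Aᵢ≈Aₖ =
      trans (congruent alt (head∷tail A))
        (alternating-equalRows (alternating-tail alt (head A)) {i} {k} i<k Aᵢ≈Aₖ)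

    -- Congruence modulo the span of the rows of M.
    infix 4 _≈_mod_
    data _≈_mod_ {n} (v w : I → Carrier) (M : Fin n → I → Carrier) : Set (c ⊔ ℓ₁ ⊔ i) where
      equal : (∀ j → v j ≈ w j) → v ≈ w mod M
      step  : ∀ k a {u} → (∀ j → v j ≈ a * M k j + u j) → u ≈ w mod M → v ≈ w mod M

    -- Each `step` splits off a multiple of a form in which row `k` of `M` occurs twice.
    mod-head : ∀ {n} {F : (Fin (suc n) → I → Carrier) → Carrier} → Alternating F →
               ∀ {v w M} → v ≈ w mod M → F (v ∷ M) ≈ F (w ∷ M)
    mod-head alt (equal v≈w) = congruent alt (∷-cong v≈w λ _ _ → refl)
    mod-head {F = F} alt {v} {w} {M} (step k a {u} v≈ u≈w) = begin
      F (v ∷ M)                      ≈⟨ linear-head alt a v≈ ⟩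
      a * F (M k ∷ M) + F (u ∷ M)    ≈⟨ +-cong (*-congˡ (alternating-equalRows alt {zero} {suc k} (s≤s z≤n) λ _ → refl))
                                               (mod-head alt u≈w) ⟩
      a * 0# + F (w ∷ M)             ≈⟨ +-congʳ (zeroʳ a) ⟩
      0# + F (w ∷ M)                 ≈⟨ +-identityˡ _ ⟩
      F (w ∷ M)                      ∎

    mod-transˡ : ∀ {n u v w} {M : Fin n → I → Carrier} → (∀ j → u j ≈ v j) → v ≈ w mod M → u ≈ w mod M
    mod-transˡ u≈v (equal v≈w)        = equal λ j → trans (u≈v j) (v≈w j)
    mod-transˡ u≈v (step k a v≈ v′≈w) = step k a (λ j → trans (u≈v j) (v≈ j)) v′≈w

    mod-trans : ∀ {n u v w} {M : Fin n → I → Carrier} → u ≈ v mod M → v ≈ w mod M → u ≈ w mod M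
    mod-trans (equal u≈v)        v≈w = mod-transˡ u≈v v≈w
    mod-trans (step k a u≈ u′≈v) v≈w = step k a u≈ (mod-trans u′≈v v≈w)

    mod-tail : ∀ {n v w} {M : Fin (suc n) → I → Carrier} → v ≈ w mod tail M → v ≈ w mod M
    mod-tail (equal v≈w)       = equal v≈w
    mod-tail (step k a v≈ u≈w) = step (suc k) a v≈ (mod-tail u≈w)

    -- This encodes A = U M with U upper triangular with diagonal `s`. The entries of U above the
    -- diagonal stay hidden in the congruences, since no determinant depends on them.
    data Triangular : ∀ {n} (s : Fin n → Carrier) (A M : Fin n → I → Carrier) → Set (c ⊔ ℓ₁ ⊔ i) where
      base   : ∀ {s A M} → Triangular {zero} s A M
      extend : ∀ {n s A M} → head A ≈ (λ j → head s * head M j) mod tail M →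
            Triangular {n} (tail s) (tail A) (tail M) → Triangular {suc n} s A M

    alternating-triangular : ∀ {n} {F : (Fin n → I → Carrier) → Carrier} → Alternating F →
                             ∀ {s A M} → Triangular s A M → F A ≈ product s * F M
    alternating-triangular alt base = trans (congruent alt λ ()) (sym (*-identityˡ _))
    alternating-triangular {F = F} alt {s} {A} {M} (extend A₀ As) = begin
      F A                                                  ≈⟨ congruent alt (head∷tail A) ⟩
      -- The lower rows are replaced before the head: the congruence of the head is modulo rows of
      -- `M`, which must already be in place.
      F (head A ∷ tail A)                                  ≈⟨ alternating-triangular (alternating-tail alt (head A)) As ⟩
      product (tail s) * F (head A ∷ tail M)               ≈⟨ *-congˡ (mod-head alt A₀) ⟩
      product (tail s) * F ((λ j → head s * head M j) ∷ tail M)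
        -- Pure scaling is `linear` with second summand zero, which leaves a form with a zero row to
        -- be removed.
        ≈⟨ *-congˡ (linear-head alt (head s) λ j → sym (+-identityʳ _)) ⟩
      product (tail s) * (head s * F (head M ∷ tail M) + F ((λ _ → 0#) ∷ tail M))
        ≈⟨ *-congˡ (+-cong (*-congˡ (congruent alt (head∷tail M))) (sym F0≈0)) ⟨
      product (tail s) * (head s * F M + 0#)               ≈⟨ *-congˡ (+-identityʳ _) ⟩
      product (tail s) * (head s * F M)                    ≈⟨ *.x∙yz≈yx∙z _ _ _ ⟩
      product s * F M                                      ∎
      where
      F0≈0 : F ((λ _ → 0#) ∷ tail M) ≈ 0#
      F0≈0 = begin
        -- The zero row is -1 times itself plus itself.
        F0           ≈⟨ linear-head alt (- 1#) (λ j → sym (trans (+-identityʳ _) (zeroʳ _))) ⟩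
        - 1# * F0 + F0 ≈⟨ +-congʳ (-1*x≈-x F0) ⟩
        - F0 + F0    ≈⟨ -‿inverseˡ F0 ⟩
        0#           ∎
        where F0 = F ((λ _ → 0#) ∷ tail M)

  det-zeroRow : ∀ {n} i {A : Matrix n} → (∀ j → A i j ≈ 0#) → det A ≈ 0#
  det-zeroRow i {A} Aᵢ≈0 = begin
    det A                  ≈⟨ det-linear i (- 1#) row (λ _ _ _ → refl) (λ _ _ _ → refl) ⟩
    - 1# * det A + det A   ≈⟨ +-congʳ (-1*x≈-x _) ⟩
    - det A + det A        ≈⟨ -‿inverseˡ _ ⟩
    0#                     ∎
    where
    row : ∀ j → A i j ≈ - 1# * A i j + A i j
    row j = trans (Aᵢ≈0 j) (sym (trans (+-congʳ (-1*x≈-x _)) (-‿inverseˡ _)))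

  -- The first column may be nonzero below the diagonal, so those terms do not vanish by their
  -- entries. They vanish because their minors keep the top row, which is zero beyond its first
  -- entry.
  det-unitriangular : ∀ {n} {A : Matrix n} → (∀ i → A i i ≈ 1#) →
                      (∀ {i j} → i Fin.< j → A i j ≈ 0#) → det A ≈ 1#
  det-unitriangular {zero}  _ _ = refl
  det-unitriangular {suc n} {A} diagonal upper = begin
    1# * A zero zero * det (λ k l → A (suc k) (suc l)) + sum rest
      ≈⟨ +-cong (*-cong (trans (*-identityˡ _) (diagonal zero))
                        (det-unitriangular (diagonal ∘ suc) (λ i<j → upper (s≤s i<j))))
                (sum-zero rest≈0) ⟩
    1# * 1# + 0#  ≈⟨ +-identityʳ _ ⟩
    1# * 1#       ≈⟨ *-identityˡ 1# ⟩
    1#            ∎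
    where
    rest : Fin n → Carrier
    rest i = (- 1#) ^ toℕ (suc i) * A (suc i) zero * det (λ k l → A (punchIn (suc i) k) (suc l))
    rest≈0 : ∀ i → rest i ≈ 0#
    -- Matching on i makes n positive, so that the minor has a zeroth row.
    rest≈0 i@zero    = trans (*-congˡ (det-zeroRow zero {λ k l → A (punchIn (suc i) k) (suc l)} λ j → upper (s≤s z≤n))) (zeroʳ _)
    rest≈0 i@(suc _) = trans (*-congˡ (det-zeroRow zero {λ k l → A (punchIn (suc i) k) (suc l)} λ j → upper (s≤s z≤n))) (zeroʳ _)

-- The ring of formal power series

module PowerSeries {c ℓ₁ ℓ₂} (K : HeytingField c ℓ₁ ℓ₂) where
  open HeytingField K hiding (zero)
  open Factorial K
  open Determinants K
  open IntegerCoefficients R using (solve; _:+_; _:*_; _:-_; _:=_; con)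
  open Relation.Binary.Reasoning.Setoid R.setoid

  infix 4 _≈ₛ_
  _≈ₛ_ : Series → Series → Set ℓ₁
  f ≈ₛ g = ∀ m → f m ≈ g m

  infixl 6 _+ₛ_
  _+ₛ_ : Series → Series → Series
  (f +ₛ g) m = f m + g m

  0ₛ : Series
  0ₛ _ = 0#

  infixr 8 _·_
  _·_ : Carrier → Series → Series
  (a · f) m = a * f m

  -- By definition `(f ⊛ g) (suc m)` unfolds to `f 0 * g (suc m) + (shift⁻ f ⊛ g) m`; the inductions
  -- on products rest on this recursion.
  shift⁻ : Series → Series
  shift⁻ f m = f (suc m)

  ⊛-cong : ∀ {f f′ g g′} → f ≈ₛ f′ → g ≈ₛ g′ → f ⊛ g ≈ₛ f′ ⊛ g′
  ⊛-cong f≈ g≈ zero    = +-congʳ (*-cong (f≈ 0) (g≈ 0))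
  ⊛-cong f≈ g≈ (suc m) = +-cong (*-cong (f≈ 0) (g≈ (suc m))) (⊛-cong (f≈ ∘ suc) g≈ m)

  0ₛ⊛ : ∀ g → 0ₛ ⊛ g ≈ₛ 0ₛ
  0ₛ⊛ g zero    = trans (+-identityʳ _) (zeroˡ _)
  0ₛ⊛ g (suc m) = trans (+-cong (zeroˡ _) (0ₛ⊛ g m)) (+-identityʳ _)

  ⊛-linear : ∀ a f f′ g → (a · f +ₛ f′) ⊛ g ≈ₛ a · (f ⊛ g) +ₛ f′ ⊛ g
  ⊛-linear a f f′ g zero = solve 4
    (λ a x y z → (a :* x :+ y) :* z :+ con (+ 0) := a :* (x :* z :+ con (+ 0)) :+ (y :* z :+ con (+ 0)))
    refl a (f 0) (f′ 0) (g 0)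
  ⊛-linear a f f′ g (suc m) = trans (+-congˡ (⊛-linear a (shift⁻ f) (shift⁻ f′) g m)) (solve 6
    (λ a x y z u v → (a :* x :+ y) :* z :+ (a :* u :+ v) := a :* (x :* z :+ u) :+ (y :* z :+ v))
    refl a (f 0) (f′ 0) (g (suc m)) ((shift⁻ f ⊛ g) m) ((shift⁻ f′ ⊛ g) m))

  ⊛-distribʳ : ∀ g f f′ → (f +ₛ f′) ⊛ g ≈ₛ f ⊛ g +ₛ f′ ⊛ g
  ⊛-distribʳ g f f′ m = begin
    ((f +ₛ f′) ⊛ g) m                ≈⟨ ⊛-cong {g = g} (λ k → +-congʳ {x = f′ k} (sym (*-identityˡ (f k)))) (λ _ → refl) m ⟩
    ((1# · f +ₛ f′) ⊛ g) m           ≈⟨ ⊛-linear 1# f f′ g m ⟩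
    1# * (f ⊛ g) m + (f′ ⊛ g) m      ≈⟨ +-congʳ (*-identityˡ _) ⟩
    (f ⊛ g) m + (f′ ⊛ g) m           ∎

  -- The mirror image of the defining recursion: the constant term is peeled off the second factor,
  -- which is what commutativity needs.
  ⊛-suc′ : ∀ f g m → (f ⊛ g) (suc m) ≈ f (suc m) * g 0 + (f ⊛ shift⁻ g) m
  ⊛-suc′ f g zero = solve 4
    (λ a b c d → a :* d :+ (b :* c :+ con (+ 0)) := b :* c :+ (a :* d :+ con (+ 0)))
    refl (f 0) (f 1) (g 0) (g 1)
  ⊛-suc′ f g (suc m) = trans (+-congˡ (⊛-suc′ (shift⁻ f) g m)) (solve 3
    (λ a b c → a :+ (b :+ c) := b :+ (a :+ c))
    refl (f 0 * g (suc (suc m))) (f (suc (suc m)) * g 0) ((shift⁻ f ⊛ shift⁻ g) m))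

  ⊛-comm : ∀ f g → f ⊛ g ≈ₛ g ⊛ f
  ⊛-comm f g zero    = +-congʳ (*-comm (f 0) (g 0))
  ⊛-comm f g (suc m) = begin
    f 0 * g (suc m) + (shift⁻ f ⊛ g) m  ≈⟨ +-cong (*-comm _ _) (⊛-comm (shift⁻ f) g m) ⟩
    g (suc m) * f 0 + (g ⊛ shift⁻ f) m  ≈⟨ ⊛-suc′ g f m ⟨
    (g ⊛ f) (suc m)                     ∎

  ⊛-assoc : ∀ f g h → (f ⊛ g) ⊛ h ≈ₛ f ⊛ (g ⊛ h)
  ⊛-assoc f g h zero = solve 3
    (λ a b c → (a :* b :+ con (+ 0)) :* c :+ con (+ 0) := a :* (b :* c :+ con (+ 0)) :+ con (+ 0))
    refl (f 0) (g 0) (h 0)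
  ⊛-assoc f g h (suc m) = begin
    (f ⊛ g) 0 * h (suc m) + ((f 0 · shift⁻ g +ₛ shift⁻ f ⊛ g) ⊛ h) m
      ≈⟨ +-congˡ (⊛-linear (f 0) (shift⁻ g) (shift⁻ f ⊛ g) h m) ⟩
    (f ⊛ g) 0 * h (suc m) + (f 0 * (shift⁻ g ⊛ h) m + ((shift⁻ f ⊛ g) ⊛ h) m)
      ≈⟨ +-congˡ (+-congˡ (⊛-assoc (shift⁻ f) g h m)) ⟩
    (f ⊛ g) 0 * h (suc m) + (f 0 * (shift⁻ g ⊛ h) m + (shift⁻ f ⊛ (g ⊛ h)) m)
      ≈⟨ solve 5 (λ a b c d e → (a :* b :+ con (+ 0)) :* c :+ (a :* d :+ e) := a :* (b :* c :+ d) :+ e)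
           refl (f 0) (g 0) (h (suc m)) ((shift⁻ g ⊛ h) m) ((shift⁻ f ⊛ (g ⊛ h)) m) ⟩
    f 0 * (g ⊛ h) (suc m) + (shift⁻ f ⊛ (g ⊛ h)) m ∎

  ⊛-identityˡ : ∀ f → 1ₛ ⊛ f ≈ₛ f
  ⊛-identityˡ f zero    = trans (+-identityʳ _) (*-identityˡ _)
  ⊛-identityˡ f (suc m) = trans (+-cong (*-identityˡ _) (0ₛ⊛ f m)) (+-identityʳ _)

  seriesRing : CommutativeRing c ℓ₁
  seriesRing = record
    { Carrier = Series ; _≈_ = _≈ₛ_ ; _+_ = _+ₛ_ ; _*_ = _⊛_
    ; -_ = λ f m → - f m ; 0# = 0ₛ ; 1# = 1ₛ
    ; isCommutativeRing = record
      { isRing = record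
        { +-isAbelianGroup = Pointwise.isAbelianGroup ℕ R.+-isAbelianGroup
        ; *-cong     = ⊛-cong
        ; *-assoc    = ⊛-assoc
        ; *-identity = ⊛-identityˡ , λ f m → trans (⊛-comm f 1ₛ m) (⊛-identityˡ f m)
        ; distrib    = (λ f g h m → trans (⊛-comm f (g +ₛ h) m) (trans (⊛-distribʳ f g h m)
                         (+-cong (⊛-comm g f m) (⊛-comm h f m))))
                     , ⊛-distribʳ
        }
      ; *-comm = ⊛-comm
      }
    }

  -- Constants and powers of t in the series ring

  module S = CommutativeRing seriesRing
  open IntegerCoefficients seriesRing
    using () renaming (solve to solveₛ; _:+_ to _⊕_; _:*_ to _⊗_; _:-_ to _⊖_; _:=_ to _⊜_; con to conₛ)
  open Algebra.Properties.Semiring.Exp S.semiring using () renaming (_^_ to _^ₛ_)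

  -- Scalars as series, so that the solver over `seriesRing` can handle them. The rows of
  -- determinants are scaled by `_·_` instead; `κ⊛` translates.
  κ : Carrier → Series
  κ u zero    = u
  κ u (suc _) = 0#

  t : Series
  t zero    = 0#
  t (suc m) = 1ₛ m

  κ-+ : ∀ u v → κ (u + v) ≈ₛ κ u +ₛ κ v
  κ-+ u v zero    = refl
  κ-+ u v (suc m) = sym (+-identityˡ 0#)

  κ⊛ : ∀ u f → κ u ⊛ f ≈ₛ u · f
  κ⊛ u f zero    = +-identityʳ _
  κ⊛ u f (suc m) = trans (+-congˡ (0ₛ⊛ f m)) (+-identityʳ _)

  κ-* : ∀ u v → κ (u * v) ≈ₛ κ u ⊛ κ v
  κ-* u v m = trans (lemma m) (sym (κ⊛ u (κ v) m))
    where
    lemma : κ (u * v) ≈ₛ u · κ v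
    lemma zero    = refl
    lemma (suc m) = sym (zeroʳ u)

  κ-sub : ∀ u v → κ (u - v) ≈ₛ κ u S.- κ v
  κ-sub u v zero    = refl
  κ-sub u v (suc m) = sym (-‿inverseʳ 0#)

  κ-cong : ∀ {u v} → u ≈ v → κ u ≈ₛ κ v
  κ-cong u≈v zero    = u≈v
  κ-cong u≈v (suc m) = refl

  κ-1 : κ 1# ≈ₛ 1ₛ
  κ-1 zero    = refl
  κ-1 (suc m) = refl

  t⊛-zero : ∀ f → (t ⊛ f) 0 ≈ 0#
  t⊛-zero f = trans (+-identityʳ _) (zeroˡ _)

  t⊛-suc : ∀ f m → (t ⊛ f) (suc m) ≈ f m
  t⊛-suc f m = trans (+-cong (zeroˡ _) (⊛-identityˡ f m)) (+-identityˡ _)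

  t^⊛-+ : ∀ r f k → (t ^ₛ r ⊛ f) (r ℕ.+ k) ≈ f k
  t^⊛-+ zero    f k = ⊛-identityˡ f k
  t^⊛-+ (suc r) f k = begin
    ((t ⊛ t ^ₛ r) ⊛ f) (suc (r ℕ.+ k)) ≈⟨ ⊛-assoc t (t ^ₛ r) f (suc (r ℕ.+ k)) ⟩
    (t ⊛ (t ^ₛ r ⊛ f)) (suc (r ℕ.+ k)) ≈⟨ t⊛-suc (t ^ₛ r ⊛ f) (r ℕ.+ k) ⟩
    (t ^ₛ r ⊛ f) (r ℕ.+ k)             ≈⟨ t^⊛-+ r f k ⟩
    f k                                ∎

  t^⊛-< : ∀ {r} f {m} → m ℕ.< r → (t ^ₛ r ⊛ f) m ≈ 0#
  t^⊛-< {suc r} f {zero}  _         = trans (⊛-assoc t (t ^ₛ r) f 0) (t⊛-zero (t ^ₛ r ⊛ f))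
  t^⊛-< {suc r} f {suc m} (s≤s m<r) = begin
    ((t ⊛ t ^ₛ r) ⊛ f) (suc m) ≈⟨ ⊛-assoc t (t ^ₛ r) f (suc m) ⟩
    (t ⊛ (t ^ₛ r ⊛ f)) (suc m) ≈⟨ t⊛-suc (t ^ₛ r ⊛ f) m ⟩
    (t ^ₛ r ⊛ f) m             ≈⟨ t^⊛-< f m<r ⟩
    0#                         ∎

  1+t-expand : ∀ u → 1+t u ≈ₛ 1ₛ +ₛ κ u ⊛ t
  1+t-expand u 0             = sym (trans (+-congˡ (trans (κ⊛ u t 0) (zeroʳ u))) (+-identityʳ 1#))
  1+t-expand u 1             = sym (trans (+-congˡ (trans (κ⊛ u t 1) (*-identityʳ u))) (+-identityˡ u))
  1+t-expand u (suc (suc m)) = sym (trans (+-congˡ (trans (κ⊛ u t (suc (suc m))) (zeroʳ u))) (+-identityˡ 0#))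

  1/[1-t]-expand : ∀ u → 1/[1-t u ] ≈ₛ 1ₛ +ₛ κ u ⊛ (t ⊛ 1/[1-t u ])
  1/[1-t]-expand u zero    = sym (trans (+-congˡ (trans (κ⊛ u (t ⊛ g) 0) (trans (*-congˡ (t⊛-zero g)) (zeroʳ u)))) (+-identityʳ 1#))
    where g = 1/[1-t u ]
  1/[1-t]-expand u (suc m) = sym (trans (+-congˡ (trans (κ⊛ u (t ⊛ g) (suc m)) (*-congˡ (t⊛-suc g m)))) (+-identityˡ _))
    where g = 1/[1-t u ]

  1/[1-t]-inverse : ∀ u → 1/[1-t u ] ⊛ (1ₛ S.- κ u ⊛ t) ≈ₛ 1ₛ
  1/[1-t]-inverse u m = begin
    (g ⊛ (1ₛ S.- κ u ⊛ t)) m                   ≈⟨ solveₛ 3 (λ g k t → g ⊗ (conₛ (+ 1) ⊖ k ⊗ t) ⊜ g ⊖ k ⊗ (t ⊗ g)) S.refl g (κ u) t m ⟩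
    g m - (κ u ⊛ (t ⊛ g)) m                    ≈⟨ +-congʳ (1/[1-t]-expand u m) ⟩
    1ₛ m + (κ u ⊛ (t ⊛ g)) m - (κ u ⊛ (t ⊛ g)) m
                                               ≈⟨ solve 2 (λ a b → a :+ b :- b := a) refl (1ₛ m) ((κ u ⊛ (t ⊛ g)) m) ⟩
    1ₛ m                                       ∎
    where g = 1/[1-t u ]

  ∏ₛ-∷ʳ : ∀ fs f → ∏ₛ (fs ∷ʳ f) ≈ₛ ∏ₛ fs ⊛ f
  ∏ₛ-∷ʳ List.[]         f   = ⊛-comm f 1ₛ
  ∏ₛ-∷ʳ (g List.∷ fs) f m = trans (⊛-cong {g} {g} (λ _ → refl) (∏ₛ-∷ʳ fs f) m) (sym (⊛-assoc g (∏ₛ fs) f m))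

  -- Parameter products and factorial powers

  module _ (a : Parameters) where

    ∏[1+t]-suc : ∀ N → ∏[1+t a ] (suc N) ≈ₛ ∏[1+t a ] N +ₛ κ (a N) ⊛ (t ⊛ ∏[1+t a ] N)
    ∏[1+t]-suc N m = begin
      -- The product is built from the front, whereas the recursion of factorial powers appends the
      -- last factor.
      ∏[1+t a ] (suc N) m                         ≡⟨ ≡.cong (λ fs → ∏ₛ fs m) (List.applyUpTo-∷ʳ (λ j → 1+t a j) N) ⟨
      ∏ₛ (applyUpTo (λ j → 1+t a j) N ∷ʳ 1+t a N) m
                                                  ≈⟨ ∏ₛ-∷ʳ (applyUpTo (λ j → 1+t a j) N) (1+t a N) m ⟩
      (A ⊛ 1+t a N) m                             ≈⟨ S.*-congˡ {A} (1+t-expand (a N)) m ⟩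
      (A ⊛ (1ₛ +ₛ κ (a N) ⊛ t)) m                 ≈⟨ solveₛ 3 (λ A k t → A ⊗ (conₛ (+ 1) ⊕ k ⊗ t) ⊜ A ⊕ k ⊗ (t ⊗ A)) S.refl A (κ (a N)) t m ⟩
      A m + (κ (a N) ⊛ (t ⊛ A)) m                 ∎
      where A = ∏[1+t a ] N

    ∏[1+t]-zero : ∀ N → ∏[1+t a ] N 0 ≈ 1#
    ∏[1+t]-zero zero    = refl
    ∏[1+t]-zero (suc N) = begin
      ∏[1+t a ] (suc N) 0                  ≈⟨ ∏[1+t]-suc N 0 ⟩
      A 0 + (κ (a N) ⊛ (t ⊛ A)) 0          ≈⟨ +-cong (∏[1+t]-zero N) (trans (κ⊛ (a N) (t ⊛ A) 0) (trans (*-congˡ (t⊛-zero A)) (zeroʳ _))) ⟩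
      1# + 0#                              ≈⟨ +-identityʳ 1# ⟩
      1#                                   ∎
      where A = ∏[1+t a ] N

    ∏[1+t]-degree : ∀ {N k} → N ℕ.< k → ∏[1+t a ] N k ≈ 0#
    ∏[1+t]-degree {zero}  {suc k} _         = refl
    ∏[1+t]-degree {suc N} {suc k} (s≤s N<k) = begin
      ∏[1+t a ] (suc N) (suc k)                  ≈⟨ ∏[1+t]-suc N (suc k) ⟩
      A (suc k) + (κ (a N) ⊛ (t ⊛ A)) (suc k)    ≈⟨ +-cong (∏[1+t]-degree (ℕ.m<n⇒m<1+n N<k))
                                                      (trans (κ⊛ (a N) (t ⊛ A) (suc k)) (*-congˡ (trans (t⊛-suc A k) (∏[1+t]-degree N<k)))) ⟩
      0# + a N * 0#                              ≈⟨ trans (+-identityˡ _) (zeroʳ _) ⟩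
      0#                                         ∎
      where A = ∏[1+t a ] N

    -- The product of the first `m` factors has degree at most `m`, so beyond that degree its
    -- quotient by 1 - tz continues geometrically: the coefficient at `suc m` is `z` times the one
    -- at `m`. The new factor 1 + t `a m` adds `a m` times the latter, giving the factor `z + a m`.
    power-coefficient : ∀ z m → [ z ∣ a ]^ m ≈ (1/[1-t z ] ⊛ ∏[1+t a ] m) m
    power-coefficient z zero    = sym (trans (+-identityʳ _) (*-identityˡ 1#))
    power-coefficient z (suc m) = begin
      [ z ∣ a ]^ m * (z + a m)                            ≈⟨ *-congʳ (power-coefficient z m) ⟩
      G m * (z + a m)                                     ≈⟨ solve 3 (λ x z a → x :* (z :+ a) := z :* x :+ a :* x) refl (G m) z (a m) ⟩
      z * G m + a m * G m                                 ≈⟨ +-congʳ (sym G-suc) ⟩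
      G (suc m) + a m * G m                               ≈⟨ +-congˡ (trans (κ⊛ (a m) (t ⊛ G) (suc m)) (*-congˡ (t⊛-suc G m))) ⟨
      G (suc m) + (κ (a m) ⊛ (t ⊛ G)) (suc m)             ≈⟨ solveₛ 4 (λ g A k t → g ⊗ (A ⊕ k ⊗ (t ⊗ A)) ⊜ g ⊗ A ⊕ k ⊗ (t ⊗ (g ⊗ A))) S.refl g A (κ (a m)) t (suc m) ⟨
      (g ⊛ (A +ₛ κ (a m) ⊛ (t ⊛ A))) (suc m)              ≈⟨ S.*-congˡ {g} (∏[1+t]-suc m) (suc m) ⟨
      (g ⊛ ∏[1+t a ] (suc m)) (suc m)                     ∎
      where
      g = 1/[1-t z ]
      A = ∏[1+t a ] m
      G = g ⊛ A
      G-suc : G (suc m) ≈ z * G m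
      G-suc = begin
        (g ⊛ A) (suc m)                                   ≈⟨ S.*-congʳ {A} (1/[1-t]-expand z) (suc m) ⟩
        ((1ₛ +ₛ κ z ⊛ (t ⊛ g)) ⊛ A) (suc m)               ≈⟨ solveₛ 4 (λ g A k t → (conₛ (+ 1) ⊕ k ⊗ (t ⊗ g)) ⊗ A ⊜ A ⊕ k ⊗ (t ⊗ (g ⊗ A))) S.refl g A (κ z) t (suc m) ⟩
        A (suc m) + (κ z ⊛ (t ⊛ G)) (suc m)               ≈⟨ +-cong (∏[1+t]-degree (ℕ.n<1+n m)) (trans (κ⊛ z (t ⊛ G) (suc m)) (*-congˡ (t⊛-suc G m))) ⟩
        0# + z * G m                                      ≈⟨ +-identityˡ _ ⟩
        z * G m                                           ∎

-- Divided differences of reciprocal series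

drop-tabulate-map : ∀ {a b n} {A : Set a} {B : Set b} (f : A → B) (z : Fin n → A) (i : Fin n) →
                    map f (drop (toℕ i) (tabulate z)) ≡ drop (toℕ i) (tabulate (f ∘ z))
drop-tabulate-map f z zero    = List.map-tabulate z f
drop-tabulate-map f z (suc i) = drop-tabulate-map f (tail z) i

zipWith-tabulate : ∀ {a b c n} {A : Set a} {B : Set b} {C : Set c} (f : A → B → C)
                   (u : Fin n → A) (v : Fin n → B) →
                   zipWith f (tabulate u) (tabulate v) ≡ tabulate (λ i → f (u i) (v i))
zipWith-tabulate {n = zero}  f u v = ≡.refl
zipWith-tabulate {n = suc n} f u v = ≡.cong (f (head u) (head v) List.∷_) (zipWith-tabulate f (tail u) (tail v))

drop-tabulate-zipWith : ∀ {a b c n} {A : Set a} {B : Set b} {C : Set c} (f : A → B → C)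
                        (u : Fin n → A) (v : Fin n → B) (i : Fin n) →
                        zipWith f (drop (toℕ i) (tabulate u)) (drop (toℕ i) (tabulate v)) ≡
                        drop (toℕ i) (tabulate (λ k → f (u k) (v k)))
drop-tabulate-zipWith f u v zero    = zipWith-tabulate f u v
drop-tabulate-zipWith f u v (suc i) = drop-tabulate-zipWith f (tail u) (tail v) i

length-drop-tabulate : ∀ {a n} {A : Set a} (z : Fin n → A) (i : Fin n) →
                       length (drop (toℕ i) (tabulate z)) ≡ suc (n ∸ suc (toℕ i))
length-drop-tabulate {n = suc n} z zero    = ≡.cong suc (List.length-tabulate (tail z))
length-drop-tabulate             z (suc i) = length-drop-tabulate (tail z) i

-- Since p + (n - 1 - p) is the same for p = i and p = j, the row index drops out: the degree in row
-- i plus the order of its power of t is the exponent of column j.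
degree-shift : ∀ {n} (i j : Fin n) l →
               (+ l ℤ.- + toℕ j ℤ.+ + toℕ i) ℤ.+ + (n ∸ suc (toℕ i)) ≡ + (l ℕ.+ (n ∸ suc (toℕ j)))
degree-shift {n} i j l = begin
  + l ℤ.- + q ℤ.+ + p ℤ.+ + (n ∸ suc p)         ≡⟨ ℤ.+-assoc (+ l ℤ.- + q) (+ p) _ ⟩
  + l ℤ.- + q ℤ.+ (+ (p ℕ.+ (n ∸ suc p)))       ≡⟨ ≡.cong (λ e → + l ℤ.- + q ℤ.+ (+ e)) (≡.trans (complement i) (≡.sym (complement j))) ⟩
  + l ℤ.- + q ℤ.+ (+ q ℤ.+ + (n ∸ suc q))       ≡⟨ ℤ.+-assoc (+ l ℤ.- + q) (+ q) _ ⟨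
  + l ℤ.- + q ℤ.+ + q ℤ.+ + (n ∸ suc q)         ≡⟨ ≡.cong (ℤ._+ + (n ∸ suc q)) (ℤ.+-assoc (+ l) (ℤ.- + q) (+ q)) ⟩
  + l ℤ.+ (ℤ.- + q ℤ.+ + q) ℤ.+ + (n ∸ suc q)   ≡⟨ ≡.cong (λ e → + l ℤ.+ e ℤ.+ + (n ∸ suc q)) (ℤ.+-inverseˡ (+ q)) ⟩
  + l ℤ.+ + 0 ℤ.+ + (n ∸ suc q)                 ≡⟨ ≡.cong (ℤ._+ + (n ∸ suc q)) (ℤ.+-identityʳ (+ l)) ⟩
  + (l ℕ.+ (n ∸ suc q))                         ∎
  where
  open ≡.≡-Reasoning
  p = toℕ i
  q = toℕ j
  complement : ∀ {n} (i : Fin n) → toℕ i ℕ.+ (n ∸ suc (toℕ i)) ≡ n ∸ 1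
  complement {suc n} i = ℕ.m+[n∸m]≡n (ℕ.≤-pred (Fin.toℕ<n i))

module DividedDifferences {c ℓ₁ ℓ₂} (K : HeytingField c ℓ₁ ℓ₂) where
  open HeytingField K hiding (zero)
  open Factorial K
  open Determinants K
  open PowerSeries K
  open Algebra.Apartness.Properties.HeytingCommutativeRing heytingCommutativeRing
    using (x-0≈x; 1#0; x#0y#0→xy#0; #-congʳ; invertibleˡ⇒#)
  open IntegerCoefficients R using (solve; _:+_; _:*_; _:-_; _:=_; con)
  open IntegerCoefficients seriesRing
    using () renaming (solve to solveₛ; _:+_ to _⊕_; _:*_ to _⊗_; _:-_ to _⊖_; _:=_ to _⊜_; con to conₛ)
  open Algebra.Properties.Semiring.Exp S.semiring using () renaming (_^_ to _^ₛ_)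
  open Relation.Binary.Reasoning.Setoid R.setoid

  -- Columns enter only as the linear functionals f ↦ [t^e] f B_e, so the properties of `det` pass
  -- to series as rows.
  alternating-coefficients : ∀ {n} (B : ℕ → Series) (e : Fin n → ℕ) →
    Alternating (λ (A : Fin n → Series) → det (λ i j → (A i ⊛ B (e j)) (e j)))
  alternating-coefficients B e = record
    { congruent = λ {A} {A′} A≈A′ → det-cong λ i j → ⊛-cong {g = B (e j)} (A≈A′ i) (λ _ → refl) (e j)
    ; linear    = λ i a {A} {A′} {A″} Aᵢ A≈A′ A≈A″ → det-linear i a
        (λ j → trans (⊛-cong {g = B (e j)} Aᵢ (λ _ → refl) (e j)) (⊛-linear a (A′ i) (A″ i) (B (e j)) (e j)))
        (λ k k≢i j → ⊛-cong {g = B (e j)} (A≈A′ k k≢i) (λ _ → refl) (e j))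
        (λ k k≢i j → ⊛-cong {g = B (e j)} (A≈A″ k k≢i) (λ _ → refl) (e j))
    ; adjacent  = λ eq Aᵢ≈Aₖ → det-adjacent eq λ j → ⊛-cong {g = B (e j)} Aᵢ≈Aₖ (λ _ → refl) (e j)
    }

  ∏from : ∀ {n} → (Fin n → Series) → Fin n → Series
  ∏from q i = ∏ₛ (drop (toℕ i) (tabulate q))

  dividedDifferences : ∀ {n} → (Fin n → Series) → Fin n → Series
  dividedDifferences {n} q i = t ^ₛ (n ∸ suc (toℕ i)) ⊛ ∏from q i

  -- The coefficient [t^m] (t^n g ∏ q) is a divided difference of order n, so this is
  -- Newton's formula with remainder; w is the node of g.
  newton : ∀ {n} p {g w} (q : Fin n → Series) (y : Fin n → Carrier) →
           (∀ k → g ≈ₛ q k +ₛ κ (w - y k) ⊛ (t ⊛ (g ⊛ q k))) →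
           p · g ≈ (p * product (λ k → w - y k)) · (t ^ₛ n ⊛ (g ⊛ ∏ₛ (tabulate q))) mod dividedDifferences q
  newton {zero} p {g} q y rel = equal λ m → *-cong (sym (*-identityʳ p))
    (solveₛ 1 (λ g → g ⊜ conₛ (+ 1) ⊗ (g ⊗ conₛ (+ 1))) S.refl g m)
  newton {suc n} p {g} {w} q y rel =
    -- Nodes are used from the last to the first, because row zero involves all of them.
    -- Substituting `rel zero` into the remainder left by the tail splits off `b` times row zero and
    -- leaves the next remainder.
    mod-trans (mod-tail (newton p (tail q) (tail y) (rel ∘ suc))) (step zero b difference (equal λ _ → refl))
    where
    a = w - y zero
    Π = product (λ k → w - y (suc k))
    b = p * Π
    T = t ^ₛ n
    P = ∏ₛ (tabulate (tail q))
    q₀ = head q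
    difference : ∀ m → b * (T ⊛ (g ⊛ P)) m ≈
      b * (T ⊛ (q₀ ⊛ P)) m + p * (a * Π) * ((t ⊛ T) ⊛ (g ⊛ (q₀ ⊛ P))) m
    difference m = begin
      b * (T ⊛ (g ⊛ P)) m
        ≈⟨ *-congˡ (S.*-congˡ {T} (S.*-congʳ {P} (rel zero)) m) ⟩
      b * (T ⊛ ((q₀ +ₛ κ a ⊛ (t ⊛ (g ⊛ q₀))) ⊛ P)) m
        ≈⟨ *-congˡ (solveₛ 6 (λ T q k t g P → T ⊗ ((q ⊕ k ⊗ (t ⊗ (g ⊗ q))) ⊗ P) ⊜ T ⊗ (q ⊗ P) ⊕ k ⊗ ((t ⊗ T) ⊗ (g ⊗ (q ⊗ P))))
             S.refl T q₀ (κ a) t g P m) ⟩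
      b * ((T ⊛ (q₀ ⊛ P)) m + (κ a ⊛ ((t ⊛ T) ⊛ (g ⊛ (q₀ ⊛ P)))) m)
        ≈⟨ *-congˡ (+-congˡ (κ⊛ a ((t ⊛ T) ⊛ (g ⊛ (q₀ ⊛ P))) m)) ⟩
      b * ((T ⊛ (q₀ ⊛ P)) m + a * ((t ⊛ T) ⊛ (g ⊛ (q₀ ⊛ P))) m)
        ≈⟨ solve 5 (λ p Π u a v → p :* Π :* (u :+ a :* v) := p :* Π :* u :+ p :* (a :* Π) :* v)
             refl p Π ((T ⊛ (q₀ ⊛ P)) m) a (((t ⊛ T) ⊛ (g ⊛ (q₀ ⊛ P))) m) ⟩
      b * (T ⊛ (q₀ ⊛ P)) m + p * (a * Π) * ((t ⊛ T) ⊛ (g ⊛ (q₀ ⊛ P))) m ∎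

  scales : ∀ {n} → (p y : Fin n → Carrier) → Fin n → Carrier
  scales p y zero    = head p * product (λ k → head y - y (suc k))
  scales p y (suc i) = scales (tail p) (tail y) i

  -- In Newton's formula for `head q` with the nodes of the tail, the remainder is itself the row at
  -- index zero, so its factor is the diagonal entry.
  triangular-dividedDifferences : ∀ {n} (p y : Fin n → Carrier) (q : Fin n → Series) →
    (∀ i k → q i ≈ₛ q k +ₛ κ (y i - y k) ⊛ (t ⊛ (q i ⊛ q k))) →
    Triangular (scales p y) (λ i → p i · q i) (dividedDifferences q)
  triangular-dividedDifferences {zero}  p y q rel = base
  triangular-dividedDifferences {suc n} p y q rel = extend
    (newton (head p) (tail q) (tail y) (λ k → rel zero (suc k)))
    (triangular-dividedDifferences (tail p) (tail y) (tail q) (λ i k → rel (suc i) (suc k)))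

  -- Apartness from zero and quotients

  product#0 : ∀ {n} {f : Fin n → Carrier} → (∀ i → f i # 0#) → product f # 0#
  product#0 {zero}  f#0 = 1#0
  product#0 {suc n} f#0 = x#0y#0→xy#0 (f#0 zero) (product#0 (f#0 ∘ suc))

  scales#0 : ∀ {n} {p y : Fin n → Carrier} → (∀ i → p i # 0#) →
             (∀ {i k} → i ≢ k → y i - y k # 0#) → ∀ i → scales p y i # 0#
  scales#0 p#0 y# zero    = x#0y#0→xy#0 (p#0 zero) (product#0 λ k → y# {zero} {suc k} (λ ()))
  scales#0 p#0 y# (suc i) = scales#0 (p#0 ∘ suc) (λ {i} {k} i≢k → y# {suc i} {suc k} (i≢k ∘ Fin.suc-injective)) i

  inv-inverseˡ : ∀ {z} (p : z # 0#) → inv z p * z ≈ 1#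
  inv-inverseˡ p = trans (*-congˡ (sym (x-0≈x _))) (proj₁ (proj₂ (#⇒invertible p)))

  -- `x` times the inverse of the product inverts `y`. This allows denominators to be cleared before
  -- an apartness is proved.
  xy#0⇒y#0 : ∀ {x y} → x * y # 0# → y # 0#
  xy#0⇒y#0 {x} {y} xy#0 = invertibleˡ⇒# (inv (x * y) xy#0 * x , (begin
    inv (x * y) xy#0 * x * (y - 0#)   ≈⟨ *-congˡ (x-0≈x y) ⟩
    inv (x * y) xy#0 * x * y          ≈⟨ *-assoc _ x y ⟩
    inv (x * y) xy#0 * (x * y)        ≈⟨ inv-inverseˡ xy#0 ⟩
    1#                                ∎))

  x#y⇒x-y#0 : ∀ {x y} → x # y → x - y # 0#
  x#y⇒x-y#0 x#y with x⁻¹ , left , _ ← #⇒invertible x#y =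
    invertibleˡ⇒# (x⁻¹ , trans (*-congˡ (x-0≈x _)) left)

  quotient : ∀ {u v w} (v#0 : v # 0#) → u ≈ v * w → u / v [ v#0 ] ≈ w
  quotient {u} {v} {w} v#0 u≈vw = begin
    u * inv v v#0       ≈⟨ *-congʳ u≈vw ⟩
    v * w * inv v v#0   ≈⟨ solve 3 (λ v w i → v :* w :* i := (i :* v) :* w) refl v w (inv v v#0) ⟩
    inv v v#0 * v * w   ≈⟨ *-congʳ (inv-inverseˡ v#0) ⟩
    1# * w              ≈⟨ *-identityˡ w ⟩
    w                   ∎

  -- Constant terms and the common determinant identity

  ∏ₛ-zero : ∀ {n} (q : Fin n → Series) → (∀ i → q i 0 ≈ 1#) → ∏ₛ (tabulate q) 0 ≈ 1#
  ∏ₛ-zero {zero}  q q≈1 = refl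
  ∏ₛ-zero {suc n} q q≈1 =
    trans (+-identityʳ _) (trans (*-cong (q≈1 zero) (∏ₛ-zero (tail q) (q≈1 ∘ suc))) (*-identityˡ 1#))

  ∏from-zero : ∀ {n} (q : Fin n → Series) → (∀ i → q i 0 ≈ 1#) → ∀ i → ∏from q i 0 ≈ 1#
  ∏from-zero q q≈1 zero    = ∏ₛ-zero q q≈1
  ∏from-zero q q≈1 (suc i) = ∏from-zero (tail q) (q≈1 ∘ suc) i

  -- Here `r` is one less than the number of variables, so `r + k` is the upper limit in degree `k`.
  -- A negative degree means `e` < `r`, where a multiple of t^r has coefficient 0, in agreement with
  -- the convention.
  coefficient-shift : ∀ (Φ : ℤ → Carrier) (F : ℕ → Series) {r e} →
                      (∀ k → Φ (+ k) ≈ F (r ℕ.+ k) k) → (∀ k → Φ -[1+ k ] ≈ 0#) →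
                      ∀ z → z ℤ.+ + r ≡ + e → Φ z ≈ (t ^ₛ r ⊛ F e) e
  coefficient-shift Φ F {r} {e} Φ⁺ Φ⁻ (+ k) z+r≡e =
    ≡.subst (λ e → Φ (+ k) ≈ (t ^ₛ r ⊛ F e) e) (≡.trans (ℕ.+-comm r k) (ℤ.+-injective z+r≡e))
      (trans (Φ⁺ k) (sym (t^⊛-+ r (F (r ℕ.+ k)) k)))
  coefficient-shift Φ F {r} {e} Φ⁺ Φ⁻ -[1+ k ] z+r≡e =
    trans (Φ⁻ k) (sym (t^⊛-< (F e) (ℤ.drop‿+<+ (≡.subst (ℤ._< + r) z+r≡e (ℤ.m⊖1+n<m r (suc k))))))


  -- The families differ only in their weights `p`, nodes `y`, series `q` and column series `B`. The
  -- apartness `d` belongs to the conclusion, as it is read off from the value `V` of the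
  -- denominator.
  jacobi-trudi : ∀ {n} (p y : Fin n → Carrier) (q : Fin n → Series) (B : ℕ → Series) →
    (∀ i → p i # 0#) → (∀ {i k} → i ≢ k → y i - y k # 0#) →
    (∀ i → q i 0 ≈ 1#) → (∀ m → B m 0 ≈ 1#) →
    (∀ i k → q i ≈ₛ q k +ₛ κ (y i - y k) ⊛ (t ⊛ (q i ⊛ q k))) →
    (f : Fin n → ℕ → Carrier) → (∀ i m → f i m ≈ p i * (q i ⊛ B m) m) →
    (l : Fin n → ℕ) (H : Matrix n) →
    (let e = λ j → l j ℕ.+ (n ∸ suc (toℕ j))) →
    (∀ i j → H i j ≈ (t ^ₛ (n ∸ suc (toℕ i)) ⊛ (∏from q i ⊛ B (e j))) (e j)) →
    Σ[ d ∈ det {n} (λ i j → f i (n ∸ suc (toℕ j))) # 0# ]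
      det (λ i j → f i (e j)) / det {n} (λ i j → f i (n ∸ suc (toℕ j))) [ d ] ≈ det H
  jacobi-trudi {n} p y q B p#0 y# q≈1 B≈1 rel f f≈ l H H≈ = d , quotient d (begin
    det (λ i j → f i (l j ℕ.+ δ j))                    ≈⟨ factor (λ j → l j ℕ.+ δ j) ⟩
    V * D (λ j → l j ℕ.+ δ j)                          ≈⟨ *-cong alternant-δ (det-cong λ i j → trans (H≈ i j) (sym (S.*-assoc (t ^ₛ δ i) (∏from q i) (B (l j ℕ.+ δ j)) (l j ℕ.+ δ j)))) ⟨
    det (λ i j → f i (δ j)) * det H                    ∎)
    where
    δ : Fin n → ℕ
    δ j = n ∸ suc (toℕ j)
    V = product (scales p y)
    D : (Fin n → ℕ) → Carrier
    D e = det (λ i j → (dividedDifferences q i ⊛ B (e j)) (e j))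
    factor : ∀ e → det (λ i j → f i (e j)) ≈ V * D e
    factor e = begin
      det (λ i j → f i (e j))                            ≈⟨ det-cong (λ i j → trans (f≈ i (e j)) (sym (scaled i j))) ⟩
      det (λ i j → ((p i · q i) ⊛ B (e j)) (e j))        ≈⟨ alternating-triangular (alternating-coefficients B e) (triangular-dividedDifferences p y q rel) ⟩
      V * D e                                            ∎
      where
      scaled : ∀ i j → ((p i · q i) ⊛ B (e j)) (e j) ≈ p i * (q i ⊛ B (e j)) (e j)
      scaled i j = begin
        ((p i · q i) ⊛ b) m           ≈⟨ S.*-congʳ {b} (κ⊛ (p i) (q i)) m ⟨
        (κ (p i) ⊛ q i ⊛ b) m         ≈⟨ S.*-assoc (κ (p i)) (q i) b m ⟩
        (κ (p i) ⊛ (q i ⊛ b)) m       ≈⟨ κ⊛ (p i) (q i ⊛ b) m ⟩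
        p i * (q i ⊛ b) m             ∎
        where
        m = e j
        b = B m
    D-δ : D δ ≈ 1#
    D-δ = det-unitriangular
      (λ i → begin
        (dividedDifferences q i ⊛ B (δ i)) (δ i)              ≈⟨ S.*-assoc (t ^ₛ δ i) (∏from q i) (B (δ i)) (δ i) ⟩
        (t ^ₛ δ i ⊛ (∏from q i ⊛ B (δ i))) (δ i)              ≡⟨ ≡.cong (t ^ₛ δ i ⊛ (∏from q i ⊛ B (δ i))) (ℕ.+-identityʳ (δ i)) ⟨
        (t ^ₛ δ i ⊛ (∏from q i ⊛ B (δ i))) (δ i ℕ.+ 0)        ≈⟨ t^⊛-+ (δ i) (∏from q i ⊛ B (δ i)) 0 ⟩
        ∏from q i 0 * B (δ i) 0 + 0#                          ≈⟨ +-identityʳ _ ⟩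
        ∏from q i 0 * B (δ i) 0                               ≈⟨ *-cong (∏from-zero q q≈1 i) (B≈1 (δ i)) ⟩
        1# * 1#                                               ≈⟨ *-identityˡ 1# ⟩
        1#                                                    ∎)
      -- Row i is a multiple of t^{δ i}, and δ decreases strictly, so for i < j the coefficient at δ
      -- j lies below that order.
      (λ {i} {j} i<j → trans (S.*-assoc (t ^ₛ δ i) (∏from q i) (B (δ j)) (δ j))
        (t^⊛-< (∏from q i ⊛ B (δ j)) (ℕ.∸-monoʳ-< (s≤s i<j) (Fin.toℕ<n j))))
    alternant-δ : det (λ i j → f i (δ j)) ≈ V
    alternant-δ = trans (factor δ) (trans (*-congˡ D-δ) (*-identityʳ V))
    d : det (λ i j → f i (δ j)) # 0#
    d = #-congʳ (sym alternant-δ) (product#0 (scales#0 p#0 y#))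

  -- The hypotheses give d′ - d = (y - y′) t; multiply by q q′.
  reciprocal-difference : ∀ {q q′ d d′ y y′ e} → q ⊛ d ≈ₛ 1ₛ → q′ ⊛ d′ ≈ₛ 1ₛ →
    d +ₛ κ y ⊛ t ≈ₛ e → d′ +ₛ κ y′ ⊛ t ≈ₛ e →
    q ≈ₛ q′ +ₛ κ (y - y′) ⊛ (t ⊛ (q ⊛ q′))
  reciprocal-difference {q} {q′} {d} {d′} {y} {y′} {e} qd≈1 q′d′≈1 d≈ d′≈ m = begin
    q m                                            ≈⟨ S.*-identityʳ q m ⟨
    (q ⊛ 1ₛ) m                                     ≈⟨ S.*-congˡ {q} q′d′≈1 m ⟨
    (q ⊛ (q′ ⊛ d′)) m                              ≈⟨ solveₛ 5 (λ q q′ d′ k t → q ⊗ (q′ ⊗ d′) ⊜ q ⊗ q′ ⊗ (d′ ⊕ k ⊗ t) ⊖ k ⊗ (t ⊗ (q ⊗ q′)))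
                                                        S.refl q q′ d′ (κ y′) t m ⟩
    (q ⊛ q′ ⊛ (d′ +ₛ κ y′ ⊛ t)) m - X              ≈⟨ +-congʳ (S.*-congˡ {q ⊛ q′} (λ k → trans (d′≈ k) (sym (d≈ k))) m) ⟩
    (q ⊛ q′ ⊛ (d +ₛ κ y ⊛ t)) m - X                ≈⟨ solveₛ 6 (λ q q′ d k k′ t → q ⊗ q′ ⊗ (d ⊕ k ⊗ t) ⊖ k′ ⊗ (t ⊗ (q ⊗ q′)) ⊜ q ⊗ d ⊗ q′ ⊕ (k ⊖ k′) ⊗ (t ⊗ (q ⊗ q′)))
                                                        S.refl q q′ d (κ y) (κ y′) t m ⟩
    (q ⊛ d ⊛ q′) m + ((κ y S.- κ y′) ⊛ (t ⊛ (q ⊛ q′))) m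
      ≈⟨ +-cong (trans (S.*-congʳ {q′} qd≈1 m) (S.*-identityˡ q′ m)) (sym (S.*-congʳ {t ⊛ (q ⊛ q′)} (κ-sub y y′) m)) ⟩
    q′ m + (κ (y - y′) ⊛ (t ⊛ (q ⊛ q′))) m         ∎
    where X = (κ y′ ⊛ (t ⊛ (q ⊛ q′))) m

  -- Over the common denominator (1 - tu)(1 - tv) the numerator is α(1 - tv) - β(1 - tu) = (α - β) +
  -- (βu - αv) t, which is (α - β)(1 + γt).
  geometric-pair : ∀ {α β γ u v} → β * u - α * v ≈ (α - β) * γ → ∀ A →
    κ α ⊛ (1/[1-t u ] ⊛ A) S.- κ β ⊛ (1/[1-t v ] ⊛ A) ≈ₛ
    κ (α - β) ⊛ (1/[1-t u ] ⊛ 1/[1-t v ] ⊛ (1+t γ ⊛ A))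
  geometric-pair {α} {β} {γ} {u} {v} eq A m = begin
    (κ α ⊛ (g ⊛ A) S.- κ β ⊛ (g′ ⊛ A)) m
      ≈⟨ S.+-cong {κ α ⊛ (g ⊛ A)} {κ α ⊛ (g ⊛ A ⊛ 1ₛ)} {S.- (κ β ⊛ (g′ ⊛ A))} {S.- (κ β ⊛ (g′ ⊛ A ⊛ 1ₛ))}
           (λ k → sym (S.*-congˡ {κ α} (S.*-identityʳ (g ⊛ A)) k)) (λ k → -‿cong (sym (S.*-congˡ {κ β} (S.*-identityʳ (g′ ⊛ A)) k))) m ⟩
    (κ α ⊛ (g ⊛ A ⊛ 1ₛ) S.- κ β ⊛ (g′ ⊛ A ⊛ 1ₛ)) m
      ≈⟨ +-cong (S.*-congˡ {κ α} (S.*-congˡ {g ⊛ A} (1/[1-t]-inverse v)) m) (-‿cong (S.*-congˡ {κ β} (S.*-congˡ {g′ ⊛ A} (1/[1-t]-inverse u)) m)) ⟨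
    (κ α ⊛ (g ⊛ A ⊛ (g′ ⊛ (1ₛ S.- κ v ⊛ t))) S.- κ β ⊛ (g′ ⊛ A ⊛ (g ⊛ (1ₛ S.- κ u ⊛ t)))) m
      ≈⟨ solveₛ 8 (λ α β u v t g g′ A →
           α ⊗ (g ⊗ A ⊗ (g′ ⊗ (conₛ (+ 1) ⊖ v ⊗ t))) ⊖ β ⊗ (g′ ⊗ A ⊗ (g ⊗ (conₛ (+ 1) ⊖ u ⊗ t))) ⊜
           g ⊗ g′ ⊗ A ⊗ (α ⊖ β ⊕ (β ⊗ u ⊖ α ⊗ v) ⊗ t)) S.refl (κ α) (κ β) (κ u) (κ v) t g g′ A m ⟩
    (g ⊛ g′ ⊛ A ⊛ (κ α S.- κ β +ₛ (κ β ⊛ κ u S.- κ α ⊛ κ v) ⊛ t)) m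
      ≈⟨ S.*-congˡ {g ⊛ g′ ⊛ A} (S.+-cong {κ α S.- κ β} {κ (α - β)} (λ k → sym (κ-sub α β k)) (S.*-congʳ {t} κ-eq)) m ⟩
    (g ⊛ g′ ⊛ A ⊛ (κ (α - β) +ₛ κ (α - β) ⊛ κ γ ⊛ t)) m
      ≈⟨ solveₛ 6 (λ g g′ A d c t → g ⊗ g′ ⊗ A ⊗ (d ⊕ d ⊗ c ⊗ t) ⊜ d ⊗ (g ⊗ g′ ⊗ ((conₛ (+ 1) ⊕ c ⊗ t) ⊗ A))) S.refl g g′ A (κ (α - β)) (κ γ) t m ⟩
    (κ (α - β) ⊛ (g ⊛ g′ ⊛ ((1ₛ +ₛ κ γ ⊛ t) ⊛ A))) m
      ≈⟨ S.*-congˡ {κ (α - β)} (S.*-congˡ {g ⊛ g′} (S.*-congʳ {A} (1+t-expand γ))) m ⟨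
    (κ (α - β) ⊛ (g ⊛ g′ ⊛ (1+t γ ⊛ A))) m ∎
    where
    g = 1/[1-t u ]
    g′ = 1/[1-t v ]
    κ-eq : κ β ⊛ κ u S.- κ α ⊛ κ v ≈ₛ κ (α - β) ⊛ κ γ
    κ-eq k = begin
      (κ β ⊛ κ u) k - (κ α ⊛ κ v) k    ≈⟨ +-cong (κ-* β u k) (-‿cong (κ-* α v k)) ⟨
      κ (β * u) k - κ (α * v) k        ≈⟨ κ-sub (β * u) (α * v) k ⟨
      κ (β * u - α * v) k              ≈⟨ κ-cong eq k ⟩
      κ ((α - β) * γ) k                ≈⟨ κ-* (α - β) γ k ⟩
      (κ (α - β) ⊛ κ γ) k              ∎

  -- Let v be the inverse of u and β that of α. Then α = u gives γ = 0, and α a square root of u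
  -- gives γ = 1: this is the origin of the factor 1 + t in the odd orthogonal functions.
  power-pair : ∀ {α β γ u v} → β * u - α * v ≈ (α - β) * γ → ∀ a m →
    α * [ u ∣ a ]^ m - β * [ v ∣ a ]^ m ≈
    (α - β) * (1/[1-t u ] ⊛ 1/[1-t v ] ⊛ (1+t γ ⊛ ∏[1+t a ] m)) m
  power-pair {α} {β} {γ} {u} {v} eq a m = begin
    α * [ u ∣ a ]^ m - β * [ v ∣ a ]^ m
      ≈⟨ +-cong (term α u) (-‿cong (term β v)) ⟩
    (κ α ⊛ (1/[1-t u ] ⊛ A)) m - (κ β ⊛ (1/[1-t v ] ⊛ A)) m
      ≈⟨ geometric-pair eq A m ⟩
    (κ (α - β) ⊛ (1/[1-t u ] ⊛ 1/[1-t v ] ⊛ (1+t γ ⊛ A))) m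
      ≈⟨ κ⊛ (α - β) (1/[1-t u ] ⊛ 1/[1-t v ] ⊛ (1+t γ ⊛ A)) m ⟩
    (α - β) * (1/[1-t u ] ⊛ 1/[1-t v ] ⊛ (1+t γ ⊛ A)) m ∎
    where
    A = ∏[1+t a ] m
    term : ∀ α u → α * [ u ∣ a ]^ m ≈ (κ α ⊛ (1/[1-t u ] ⊛ A)) m
    term α u = trans (*-congˡ (power-coefficient a u m)) (sym (κ⊛ α (1/[1-t u ] ⊛ A) m))

  1/[1-t]-difference : ∀ u v → 1/[1-t u ] ≈ₛ 1/[1-t v ] +ₛ κ (u - v) ⊛ (t ⊛ (1/[1-t u ] ⊛ 1/[1-t v ]))
  1/[1-t]-difference u v = reciprocal-difference (1/[1-t]-inverse u) (1/[1-t]-inverse v) (cancel u) (cancel v)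
    where
    cancel : ∀ u → 1ₛ S.- κ u ⊛ t +ₛ κ u ⊛ t ≈ₛ 1ₛ
    cancel u = solveₛ 2 (λ a b → a ⊖ b ⊕ b ⊜ a) S.refl 1ₛ (κ u ⊛ t)

  -- (1 - tu)(1 - tū) + t(u + ū) = 1 + t² does not depend on u.
  1/[1-t]-pair-difference : ∀ {u ū v v̄} → u * ū ≈ 1# → v * v̄ ≈ 1# →
    (let q = 1/[1-t u ] ⊛ 1/[1-t ū ]; q′ = 1/[1-t v ] ⊛ 1/[1-t v̄ ]) →
    q ≈ₛ q′ +ₛ κ ((u + ū) - (v + v̄)) ⊛ (t ⊛ (q ⊛ q′))
  1/[1-t]-pair-difference {u} {ū} {v} {v̄} uū≈1 vv̄≈1 =
    reciprocal-difference (inverse u ū) (inverse v v̄) (complete uū≈1) (complete vv̄≈1)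
    where
    d : Carrier → Carrier → Series
    d u ū = (1ₛ S.- κ u ⊛ t) ⊛ (1ₛ S.- κ ū ⊛ t)
    inverse : ∀ u ū → 1/[1-t u ] ⊛ 1/[1-t ū ] ⊛ d u ū ≈ₛ 1ₛ
    inverse u ū m = begin
      (g ⊛ g′ ⊛ (x ⊛ y)) m  ≈⟨ solveₛ 4 (λ g g′ x y → g ⊗ g′ ⊗ (x ⊗ y) ⊜ g ⊗ x ⊗ (g′ ⊗ y)) S.refl g g′ x y m ⟩
      (g ⊛ x ⊛ (g′ ⊛ y)) m  ≈⟨ S.*-cong (1/[1-t]-inverse u) (1/[1-t]-inverse ū) m ⟩
      (1ₛ ⊛ 1ₛ) m          ≈⟨ S.*-identityˡ 1ₛ m ⟩
      1ₛ m                 ∎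
      where
      g = 1/[1-t u ]
      g′ = 1/[1-t ū ]
      x = 1ₛ S.- κ u ⊛ t
      y = 1ₛ S.- κ ū ⊛ t
    complete : ∀ {u ū} → u * ū ≈ 1# → d u ū +ₛ κ (u + ū) ⊛ t ≈ₛ 1ₛ +ₛ t ⊛ t
    complete {u} {ū} uū≈1 m = begin
      d u ū m + (κ (u + ū) ⊛ t) m              ≈⟨ +-congˡ (S.*-congʳ {t} (κ-+ u ū) m) ⟩
      d u ū m + ((κ u +ₛ κ ū) ⊛ t) m           ≈⟨ solveₛ 3 (λ k k′ t → (conₛ (+ 1) ⊖ k ⊗ t) ⊗ (conₛ (+ 1) ⊖ k′ ⊗ t) ⊕ (k ⊕ k′) ⊗ t ⊜ conₛ (+ 1) ⊕ k ⊗ k′ ⊗ (t ⊗ t))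
                                                    S.refl (κ u) (κ ū) t m ⟩
      1ₛ m + (κ u ⊛ κ ū ⊛ (t ⊛ t)) m           ≈⟨ +-congˡ (S.*-congʳ {t ⊛ t} κ-one m) ⟩
      1ₛ m + (1ₛ ⊛ (t ⊛ t)) m                  ≈⟨ +-congˡ (S.*-identityˡ (t ⊛ t) m) ⟩
      1ₛ m + (t ⊛ t) m                         ∎
      where
      κ-one : κ u ⊛ κ ū ≈ₛ 1ₛ
      κ-one k = trans (sym (κ-* u ū k)) (trans (κ-cong uū≈1 k) (κ-1 k))

-- The three families of characters

module FactorialCharacters {c ℓ₁ ℓ₂} (K : HeytingField c ℓ₁ ℓ₂) where
  open HeytingField K hiding (zero)
  open Factorial K
  open Determinants K
  open PowerSeries K
  open DividedDifferences K
  open Algebra.Apartness.Properties.HeytingCommutativeRing heytingCommutativeRing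
    using (1#0; x#0y#0→xy#0; #-congʳ)
  open IntegerCoefficients R using (solve; _:+_; _:*_; _:-_; _:=_; con)
  open IntegerCoefficients seriesRing using () renaming (solve to solveₛ; _:*_ to _⊗_; _:=_ to _⊜_)
  open Relation.Binary.Reasoning.Setoid R.setoid

  -- Apartness of the weights and nodes

  module _ {n} (X : Variables n) where
    open Variables X

    x½x̄½≈1 : ∀ i → x½ i * x̄½ i ≈ 1#
    x½x̄½≈1 i = trans (*-comm _ _) (inv-inverseˡ (x½#0 i))

    xx̄≈1 : ∀ i → x i * x̄ i ≈ 1#
    xx̄≈1 i = trans (*-comm _ _) (inv-inverseˡ (x#0y#0→xy#0 (x½#0 i) (x½#0 i)))

    x̄½x≈x½ : ∀ i → x̄½ i * x i ≈ x½ i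
    x̄½x≈x½ i = begin
      x̄½ i * (x½ i * x½ i)   ≈⟨ solve 2 (λ a b → b :* (a :* a) := (a :* b) :* a) refl (x½ i) (x̄½ i) ⟩
      x½ i * x̄½ i * x½ i     ≈⟨ *-congʳ (x½x̄½≈1 i) ⟩
      1# * x½ i              ≈⟨ *-identityˡ _ ⟩
      x½ i                   ∎

    x½x̄≈x̄½ : ∀ i → x½ i * x̄ i ≈ x̄½ i
    x½x̄≈x̄½ i = begin
      x½ i * x̄ i               ≈⟨ *-congʳ (x̄½x≈x½ i) ⟨
      x̄½ i * x i * x̄ i         ≈⟨ *-assoc _ _ _ ⟩
      x̄½ i * (x i * x̄ i)       ≈⟨ *-congˡ (xx̄≈1 i) ⟩
      x̄½ i * 1#                ≈⟨ *-identityʳ _ ⟩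
      x̄½ i                     ∎

    -- Multiplication by x gives x² - 1, covered by `xᵢxⱼ#1` on the diagonal.
    x-x̄#0 : ∀ i → x i - x̄ i # 0#
    x-x̄#0 i = xy#0⇒y#0 (#-congʳ (sym (begin
      x i * (x i - x̄ i)        ≈⟨ solve 2 (λ a b → a :* (a :- b) := a :* a :- a :* b) refl (x i) (x̄ i) ⟩
      x i * x i - x i * x̄ i    ≈⟨ +-congˡ (-‿cong (xx̄≈1 i)) ⟩
      x i * x i - 1#           ∎)) (x#y⇒x-y#0 (xᵢxⱼ#1 i i)))

    -- Multiplication by `x½ i` alone gives x - 1, whereas `xᵢxⱼ#1` speaks of x²; the further factor
    -- x + 1 completes x² - 1.
    x½-x̄½#0 : ∀ i → x½ i - x̄½ i # 0#
    x½-x̄½#0 i = xy#0⇒y#0 (#-congʳ (sym (begin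
      (x i + 1#) * x½ i * (x½ i - x̄½ i)
        ≈⟨ solve 3 (λ a b e → (a :* a :+ e) :* a :* (a :- b) := (a :* a :+ e) :* (a :* a :- a :* b)) refl (x½ i) (x̄½ i) 1# ⟩
      (x i + 1#) * (x i - x½ i * x̄½ i)
        ≈⟨ *-congˡ (+-congˡ (-‿cong (x½x̄½≈1 i))) ⟩
      (x i + 1#) * (x i - 1#)
        ≈⟨ solve 1 (λ a → (a :+ con (+ 1)) :* (a :- con (+ 1)) := a :* a :- con (+ 1)) refl (x i) ⟩
      x i * x i - 1# ∎)) (x#y⇒x-y#0 (xᵢxⱼ#1 i i)))

    -- Clearing denominators, the difference times x_i x_k factors as (x_i - x_k)(x_i x_k - 1).
    x+x̄-#0 : ∀ {i k} → i ≢ k → (x i + x̄ i) - (x k + x̄ k) # 0#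
    x+x̄-#0 {i} {k} i≢k = xy#0⇒y#0 (#-congʳ (sym (begin
      x i * x k * ((x i + x̄ i) - (x k + x̄ k))
        ≈⟨ solve 4 (λ a ā b b̄ → a :* b :* ((a :+ ā) :- (b :+ b̄)) := a :* a :* b :+ a :* ā :* b :- a :* b :* b :- a :* (b :* b̄))
             refl (x i) (x̄ i) (x k) (x̄ k) ⟩
      x i * x i * x k + x i * x̄ i * x k - x i * x k * x k - x i * (x k * x̄ k)
        ≈⟨ +-cong (+-congʳ (+-congˡ (*-congʳ (xx̄≈1 i)))) (-‿cong (*-congˡ (xx̄≈1 k))) ⟩
      x i * x i * x k + 1# * x k - x i * x k * x k - x i * 1#
        ≈⟨ solve 2 (λ a b → a :* a :* b :+ con (+ 1) :* b :- a :* b :* b :- a :* con (+ 1) := (a :- b) :* (a :* b :- con (+ 1)))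
             refl (x i) (x k) ⟩
      (x i - x k) * (x i * x k - 1#) ∎))
      (x#0y#0→xy#0 (x#y⇒x-y#0 (xᵢ#xⱼ i≢k)) (x#y⇒x-y#0 (xᵢxⱼ#1 i k))))

    -- The general linear, symplectic and odd orthogonal instances

    module _ (a : Parameters) (l : Fin n → ℕ) where
      open Characters X a

      pair : Fin n → Series
      pair i = 1/[1-t x i ] ⊛ 1/[1-t x̄ i ]

      pair-zero : ∀ i → pair i 0 ≈ 1#
      pair-zero i = trans (+-identityʳ _) (*-identityˡ 1#)

      pair-difference : ∀ i k → pair i ≈ₛ pair k +ₛ κ ((x i + x̄ i) - (x k + x̄ k)) ⊛ (t ⊛ (pair i ⊛ pair k))
      pair-difference i k = 1/[1-t]-pair-difference (xx̄≈1 i) (xx̄≈1 k)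

      upperLimit : ∀ (i : Fin n) k → length (x from i) ℕ.+ k ∸ 1 ≡ n ∸ suc (toℕ i) ℕ.+ k
      upperLimit i k = ≡.cong (λ e → e ℕ.+ k ∸ 1) (length-drop-tabulate x i)

      s-jacobi-trudi : Σ[ d ∈ s-alternant ∅ # 0# ]
        s l d ≈ det {n} λ i j → h (+ l j ℤ.- + toℕ j ℤ.+ + toℕ i) (x from i) a
      s-jacobi-trudi = jacobi-trudi (λ _ → 1#) x (λ i → 1/[1-t x i ]) ∏[1+t a ]
        (λ _ → 1#0) (λ i≢k → x#y⇒x-y#0 (xᵢ#xⱼ i≢k)) (λ _ → refl) (∏[1+t]-zero a)
        (λ i k → 1/[1-t]-difference (x i) (x k))
        (λ i m → [ x i ∣ a ]^ m) (λ i m → trans (power-coefficient a (x i) m) (sym (*-identityˡ _)))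
        l (λ i j → h (+ l j ℤ.- + toℕ j ℤ.+ + toℕ i) (x from i) a)
        (λ i j → coefficient-shift (λ z → h z (x from i) a) (λ N → ∏from (λ k → 1/[1-t x k ]) i ⊛ ∏[1+t a ] N)
          (λ k → reflexive (≡.cong₂ (λ fs N → (∏ₛ fs ⊛ ∏[1+t a ] N) k) (drop-tabulate-map 1/[1-t_] x i) (upperLimit i k)))
          (λ _ → refl) (+ l j ℤ.- + toℕ j ℤ.+ + toℕ i) (degree-shift i j (l j)))

      sp-jacobi-trudi : Σ[ d ∈ sp-alternant ∅ # 0# ]
        sp l d ≈ det {n} λ i j → hˢᵖ (+ l j ℤ.- + toℕ j ℤ.+ + toℕ i) (x from i) (x̄ from i) a
      sp-jacobi-trudi = jacobi-trudi (λ i → x i - x̄ i) (λ i → x i + x̄ i) pair ∏[1+t a ]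
        x-x̄#0 x+x̄-#0 pair-zero (∏[1+t]-zero a) pair-difference
        (λ i m → x i * [ x i ∣ a ]^ m - x̄ i * [ x̄ i ∣ a ]^ m)
        -- In the symplectic case γ = 0 leaves a factor 1 + 0t, which `drop-unit` removes.
        (λ i m → trans (power-pair {γ = 0#} (commute i) a m) (*-congˡ (S.*-congˡ {pair i} (drop-unit m) m)))
        l (λ i j → hˢᵖ (+ l j ℤ.- + toℕ j ℤ.+ + toℕ i) (x from i) (x̄ from i) a)
        (λ i j → coefficient-shift (λ z → hˢᵖ z (x from i) (x̄ from i) a) (λ N → ∏from pair i ⊛ ∏[1+t a ] N)
          (λ k → reflexive (≡.cong₂ (λ fs N → (∏ₛ fs ⊛ ∏[1+t a ] N) k)
            (drop-tabulate-zipWith (λ u ū → 1/[1-t u ] ⊛ 1/[1-t ū ]) x x̄ i) (upperLimit i k)))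
          (λ _ → refl) (+ l j ℤ.- + toℕ j ℤ.+ + toℕ i) (degree-shift i j (l j)))
        where
        commute : ∀ i → x̄ i * x i - x i * x̄ i ≈ (x i - x̄ i) * 0#
        commute i = solve 2 (λ a b → b :* a :- a :* b := (a :- b) :* con (+ 0)) refl (x i) (x̄ i)
        drop-unit : ∀ m → 1+t 0# ⊛ ∏[1+t a ] m ≈ₛ ∏[1+t a ] m
        drop-unit m k = trans (S.*-congʳ {∏[1+t a ] m} 1+t0≈1 k) (S.*-identityˡ (∏[1+t a ] m) k)
          where
          1+t0≈1 : 1+t 0# ≈ₛ 1ₛ
          1+t0≈1 0             = refl
          1+t0≈1 1             = refl
          1+t0≈1 (suc (suc _)) = refl

      so-jacobi-trudi : Σ[ d ∈ so-alternant ∅ # 0# ]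
        so l d ≈ det {n} λ i j → hˢᵒ (+ l j ℤ.- + toℕ j ℤ.+ + toℕ i) (x from i) (x̄ from i) a
      -- The factor 1 + t occurs once per function and not once per variable, so it is counted with
      -- the column series and the `pair` relation is the symplectic one.
      so-jacobi-trudi = jacobi-trudi (λ i → x½ i - x̄½ i) (λ i → x i + x̄ i) pair (λ m → 1+t 1# ⊛ ∏[1+t a ] m)
        x½-x̄½#0 x+x̄-#0 pair-zero
        (λ m → trans (+-identityʳ _) (trans (*-identityˡ _) (∏[1+t]-zero a m))) pair-difference
        (λ i m → x½ i * [ x i ∣ a ]^ m - x̄½ i * [ x̄ i ∣ a ]^ m)
        (λ i m → power-pair {γ = 1#} (swap i) a m)
        l (λ i j → hˢᵒ (+ l j ℤ.- + toℕ j ℤ.+ + toℕ i) (x from i) (x̄ from i) a)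
        (λ i j → coefficient-shift (λ z → hˢᵒ z (x from i) (x̄ from i) a) (λ N → ∏from pair i ⊛ (1+t 1# ⊛ ∏[1+t a ] N))
          (λ k → trans
            (reflexive (≡.cong₂ (λ fs N → (1+t 1# ⊛ ∏ₛ fs ⊛ ∏[1+t a ] N) k)
              (drop-tabulate-zipWith (λ u ū → 1/[1-t u ] ⊛ 1/[1-t ū ]) x x̄ i) (upperLimit i k)))
            (solveₛ 3 (λ u P A → u ⊗ P ⊗ A ⊜ P ⊗ (u ⊗ A)) S.refl (1+t 1#) (∏from pair i) (∏[1+t a ] (n ∸ suc (toℕ i) ℕ.+ k)) k))
          (λ _ → refl) (+ l j ℤ.- + toℕ j ℤ.+ + toℕ i) (degree-shift i j (l j)))
        where
        swap : ∀ i → x̄½ i * x i - x½ i * x̄ i ≈ (x½ i - x̄½ i) * 1#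
        swap i = trans (+-cong (x̄½x≈x½ i) (-‿cong (x½x̄≈x̄½ i))) (sym (*-identityʳ _))

theorem2p4 : ∀ {c ℓ₁ ℓ₂} (K : HeytingField c ℓ₁ ℓ₂) →
  let open HeytingField K
      open Factorial K
  in
  (n : ℕ) .{{_ : NonZero n}} (X : Variables n) (a : Parameters) →
  let open Variables X
      open Characters X a
  in
  (l : Fin n → ℕ) → l Preserves Fin._≤_ ⟶ ℕ._≥_ →
  (Σ[ d ∈ s-alternant ∅ # 0# ]
    s l d ≈ det {n} (λ i j →
      h (+ l j ℤ.- + toℕ j ℤ.+ + toℕ i) (x from i) a))
  ×
  (Σ[ d ∈ sp-alternant ∅ # 0# ]
    sp l d ≈ det {n} (λ i j →
      hˢᵖ (+ l j ℤ.- + toℕ j ℤ.+ + toℕ i) (x from i) (x̄ from i) a))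
  ×
  (Σ[ d ∈ so-alternant ∅ # 0# ]
    so l d ≈ det {n} (λ i j →
      hˢᵒ (+ l j ℤ.- + toℕ j ℤ.+ + toℕ i) (x from i) (x̄ from i) a))
theorem2p4 K n X a l _ = s-jacobi-trudi X a l , sp-jacobi-trudi X a l , so-jacobi-trudi X a l
  where open FactorialCharacters K
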